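{- Let $\Sigma$ be an alphabet and let $\varepsilon>0$ be such that $|\Sigma|^2/\varepsilon=O(n)$. Any $R$-pass deterministic algorithm in the asymmetric streaming model that computes a $(1+\varepsilon)$-approximation of $\mathsf{LCS}(x,y)$ for two strings $x,y\in\Sigma^n$ must use space $\Omega\!\left(\frac{|\Sigma|}{\varepsilon}/R\right)$.
   Context: $\mathsf{LCS}(x,y)$ is the length of a longest common subsequence of $x$ and $y$. A $(1+\varepsilon)$-approximation means outputting a value $\lambda$ with $\mathsf{LCS}(x,y)\le\lambda\le(1+\varepsilon)\mathsf{LCS}(x,y)$. In the asymmetric streaming model, the algorithm has streaming access to $x$ (reading it left to right, once per pass; $R$ passes) and random access to $y$; space is the working memory of the algorithm.
   Formalization: The alphabet is assumed to have at least two letters: for a one-letter alphabet LCS(x,y)=n always, so no space is needed and the claimed bound fails (e.g. ε=1/n). ε is taken rational, which is equivalent since the claim passes to real ε by approximation from above. -}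

module Defs where

open import Data.Nat using (ℕ; zero; suc; _^_; _≤_)
open import Data.Fin using (Fin)
open import Data.Vec using (Vec; []; _∷_; toList; allFin; zip)
open import Data.List using (List; length)
open import Data.List.Relation.Binary.Sublist.Propositional using (_⊆_)
open import Data.Product using (Σ; _×_; _,_; ∃-syntax)
open import Data.Integer using (+_)
open import Data.Rational as ℚ using (ℚ; _/_; 1ℚ)

⟦_⟧ : ℕ → ℚ
⟦ n ⟧ = (+ n) / 1

CommonSubseq : {A : Set} → List A → List A → List A → Set
CommonSubseq z x y = (z ⊆ x) × (z ⊆ y)

IsLCS : {A : Set} → List A → List A → ℕ → Set
IsLCS x y m =
  (∃[ z ] (CommonSubseq z x y × length z ≡' m))
  × (∀ z → CommonSubseq z x y → length z ≤ m)
  where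
  open import Relation.Binary.PropositionalEquality renaming (_≡_ to _≡'_)

-- A deterministic R-pass algorithm in the asymmetric streaming model over
-- alphabet Σ = Fin k, on inputs x , y ∈ Σ^n, with s bits of working memory:
-- its memory configurations are the 2^s elements of Fin (2 ^ s).
-- y is random access: every transition/output may depend on all of y
-- (this only strengthens the algorithm, hence the lower bound).
-- Transitions may also depend on the pass number and position (non-uniform).
record Alg (k n R s : ℕ) : Set where
  field
    init : Vec (Fin k) n → Fin (2 ^ s)
    step : Fin R → Fin n → Vec (Fin k) n → Fin (2 ^ s) → Fin k → Fin (2 ^ s)
    out  : Vec (Fin k) n → Fin (2 ^ s) → ℚ

module _ {k n R s : ℕ} (A : Alg k n R s) (y x : Vec (Fin k) n) where
  open Alg A

  runPass : Fin R → Fin (2 ^ s) → Fin (2 ^ s)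
  runPass r m = go (zip (allFin n) x) m
    where
    go : {l : ℕ} → Vec (Fin n × Fin k) l → Fin (2 ^ s) → Fin (2 ^ s)
    go [] m = m
    go ((i , a) ∷ rest) m = go rest (step r i y m a)

  runAll : Fin (2 ^ s)
  runAll = go (toList (allFin R)) (init y)
    where
    go : List (Fin R) → Fin (2 ^ s) → Fin (2 ^ s)
    go Data.List.[] m = m
    go (r Data.List.∷ rs) m = go rs (runPass r m)

  output : ℚ
  output = out y runAll

Approximates : {k n R s : ℕ} → Alg k n R s → ℚ → Set
Approximates {k} {n} A ε =
  ∀ (x y : Vec (Fin k) n) (m : ℕ) → IsLCS (toList x) (toList y) m →
    (⟦ m ⟧ ℚ.≤ output A y x) × (output A y x ℚ.≤ (1ℚ ℚ.+ ε) ℚ.* ⟦ m ⟧)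

{-# OPTIONS --safe #-}
module Submission where

-- A hidden word h is sent as h h h …, and y is chosen so that its LCS
-- with any such input is small.  With less memory than the entropy of a single
-- hidden word, most blocks can be replaced by many other words without any
-- pass noticing: the block enters and leaves in the same memory states.  A
-- double count over blocks and over diagonals (offset σ, a-th deviation near block
-- σ + 3a) yields one h and a sequence of unnoticed deviations, one for a constant
-- fraction of the indices a, in increasing order, which raises the LCS by more
-- than the factor 1 + ε.
--
-- For ε ≳ 1/C hidden words are tuples of w ~ k/(Cε) symbols and y = 1 2 … k: constant
-- inputs have LCS at most w, while deviations spell out an increasing sequence of
-- length Ω(k).  For ε ≲ 1/C the alphabet is cut into k/2 pairs α, β; a hidden word
-- holds z ~ 1/(Cε) bits per pair, y is a product of α^N β^(2z+1) α^N, and each deviation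
-- lets one more α be matched.

open import Data.Bool using (Bool; true; false; if_then_else_)
open import Data.Bool.Properties as Boolₚ using ()
open import Data.Fin as Fin using (Fin; zero; suc; toℕ; fromℕ)
open import Data.Fin.Properties as Finₚ using ()
open import Data.Integer as ℤ using ()
open import Data.Integer.Properties as ℤₚ using ()
open import Data.List as List using (List; []; _∷_; _++_; length; filter; allFin; concat; tabulate; replicate; mapMaybe)
open import Data.List.Membership.Propositional using (_∈_; find; _∉_; lose)
open import Data.List.Membership.Propositional.Properties as ∈ₚ using ()
open import Data.List.Properties as Listₚ using ()
open import Data.List.Relation.Binary.Sublist.Propositional as ⊆ using (_⊆_; []; _∷_; _∷ʳ_; minimum; from∈; ⊆-trans; ⊆-refl; ⊆-reflexive)
open import Data.List.Relation.Binary.Sublist.Propositional.Properties as ⊆ₚ using ()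
open import Data.List.Relation.Unary.All as All using (All; []; _∷_)
open import Data.List.Relation.Unary.AllPairs using ([]; _∷_)
open import Data.List.Relation.Unary.Any using (here; there; Any; any?)
open import Data.List.Relation.Unary.Unique.Propositional using (Unique)
open import Data.List.Relation.Unary.Unique.Propositional.Properties as Uniqueₚ using ()
open import Data.Maybe using (Maybe; just; nothing)
open import Data.Nat as ℕ using (ℕ; zero; suc; _+_; _*_; _^_; _≤_; _<_; z≤n; s≤s; _∸_; _≤?_)
open import Data.Nat.DivMod as DivMod using (_/_; _mod_; _%_)
open import Data.Nat.Properties as ℕₚ using ()
open import Data.Nat.Tactic.RingSolver using (solve-∀)
open import Data.Product using (_×_; _,_; proj₁; proj₂; ∃-syntax; ∃₂)
open import Data.Product.Properties as ×ₚ using ()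
open import Data.Rational as ℚ using (ℚ; 0ℚ; 1ℚ; mkℚ; toℚᵘ)
open import Data.Rational.Properties as ℚₚ using ()
open import Data.Rational.Unnormalised as ℚᵘ using (ℚᵘ; mkℚᵘ)
open import Data.Rational.Unnormalised.Properties as ℚᵘₚ using ()
open import Data.Sum using (inj₁; inj₂; _⊎_)
open import Data.Unit using (tt)
open import Data.Vec as Vec using (Vec; []; _∷_)
open import Data.Vec.Properties as Vecₚ using ()
open import Defs
open import Function using (_∘_; const)
open import Relation.Binary.Definitions using (DecidableEquality)
open import Relation.Binary.PropositionalEquality
open import Relation.Nullary using (Dec; yes; no; does; ¬_; contradiction; ¬?)
open import Relation.Nullary.Decidable using (dec-true; decidable-stable)

-- Runs of a streaming algorithm on block-structured inputs

-- Runs are compared only with runs on constant inputs h h h ...: over all passes, the states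
-- entering and leaving one block take at most 2^(2sR) values, so a hidden word with more entropy
-- than that usually shares its values with many others. Which others depends on the block and is up
-- to the algorithm, whereas an LCS needs the deviations in a prescribed order. Averaging over the
-- offset σ resolves this conflict at the cost of a factor 2.
--
-- Two constructions are needed because an increasing sequence has length at most k, while the
-- entropy sought is of order k/ε: for small ε the tuples outgrow the alphabet and the gap
-- disappears. With binary gadgets both LCS values are of order kz and a deviation adds only 1, so
-- the upper bound for constant inputs must be exact. Hence the number 2z + 1 of β's: in a word
-- whose period has 2z β's and z α's, that many consecutive β's enclose exactly z α's, whatever the
-- phase and the bits. Trading those α's for the β's gains z + 1, a value that h cannot influence.

module _ {k n R s : ℕ} (A : Alg k n R s) (y : Vec (Fin k) n) where

  run : Fin R → {l : ℕ} → Vec (Fin n × Fin k) l → Fin (2 ^ s) → Fin (2 ^ s)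
  run r [] m = m
  run r ((i , a) ∷ v) m = run r v (Alg.step A r i y m a)

  run-++ : ∀ r {l l′ p} (is : Vec (Fin n) (l + l′)) (xs : Vec (Fin k) l) (ys : Vec (Fin k) l′) →
           run r (Vec.zip is (xs Vec.++ ys)) p ≡
           run r (Vec.zip (Vec.drop l is) ys) (run r (Vec.zip (Vec.take l is) xs) p)
  run-++ r is [] ys = refl
  run-++ r (i ∷ is) (x ∷ xs) ys = run-++ r is xs ys

-- The loop inside runPass is local to its where-block, so it can only be
-- referred to by unification.  That needs the length of the remaining input to
-- be a variable different from n, which is the case after one unfolding.
mutual
  run-unique : ∀ {k n R s} (A : Alg k n R s) (y x : Vec (Fin k) n) (r : Fin R) (m₀ : Fin (2 ^ s))
               {l : ℕ} (v : Vec (Fin n × Fin k) l) (m : Fin (2 ^ s)) → _ ≡ run A y r v m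
  run-unique A y x r m₀ [] m = refl
  run-unique A y x r m₀ ((i , a) ∷ v) m = run-unique A y x r m₀ v (Alg.step A r i y m a)

  runPass≡run : ∀ {k n R s} (A : Alg k n R s) (y x : Vec (Fin k) n) (r : Fin R) (m : Fin (2 ^ s)) →
                runPass A y x r m ≡ run A y r (Vec.zip (Vec.allFin n) x) m
  runPass≡run {n = zero} A y [] r m = refl
  runPass≡run {n = suc l} A y (a ∷ x) r m
    with Alg.step A r zero y m a | Vec.zip {A = Fin (suc l)} (Vec.tabulate suc) x
  ... | m₁ | v with suc l | a ∷ x
  ... | _ | x′ = run-unique A y x′ r m v m₁

passes : ∀ {R} {S : Set} → (Fin R → S → S) → List (Fin R) → S → S
passes f [] m = m
passes f (r ∷ rs) m = passes f rs (f r m)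

mutual
  -- The loop of `runAll` is local too. Abstracting the list of passes and the start state lets
  -- unification name it.
  passes-unique : ∀ {k n R s} (A : Alg k n R s) (y x : Vec (Fin k) n)
                  (rs : List (Fin R)) (m : Fin (2 ^ s)) → _ ≡ passes (runPass A y x) rs m
  passes-unique A y x [] m = refl
  passes-unique A y x (r ∷ rs) m = passes-unique A y x rs (runPass A y x r m)

  runAll≡passes : ∀ {k n R s} (A : Alg k n R s) (y x : Vec (Fin k) n) →
                  runAll A y x ≡ passes (runPass A y x) (Vec.toList (Vec.allFin R)) (Alg.init A y)
  runAll≡passes {R = R} A y x with Vec.toList (Vec.allFin R) | Alg.init A y
  ... | rs | m = passes-unique A y x rs m

passes-cong : ∀ {R} {S : Set} {f g : Fin R → S → S} → (∀ r m → f r m ≡ g r m) →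
              ∀ rs m → passes f rs m ≡ passes g rs m
passes-cong f≗g [] m = refl
passes-cong {g = g} f≗g (r ∷ rs) m = trans (cong (passes _ rs) (f≗g r m)) (passes-cong f≗g rs (g r m))

-- Cut and paste of runs

module _ {H S : Set} where

  states : (ℕ → H → S → S) → (ℕ → H) → S → ℕ → S
  states op z m zero = m
  states op z m (suc j) = op j (z j) (states op z m j)

  states-front : ∀ op z m j → states op z m (suc j) ≡ states (op ∘ suc) (z ∘ suc) (op 0 (z 0) m) j
  states-front op z m zero = refl
  states-front op z m (suc j) = cong (op (suc j) (z (suc j))) (states-front op z m j)

  module _ {R : ℕ} (op : Fin R → ℕ → H → S → S) (pre : Fin R → S → S) (t : ℕ) where

    boundary : (ℕ → H) → Fin R → S → ℕ → S
    boundary z r m = states (op r) z (pre r m)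

    -- For every pass, the states entering and leaving block `j` in the run on the constant input
    -- `h`. The start state of the next pass comes from that same run, whose passes have `t` blocks.
    signature : ℕ → (rs : List (Fin R)) → S → H → Vec (S × S) (length rs)
    signature j [] m h = []
    signature j (r ∷ rs) m h =
      (boundary (const h) r m j , boundary (const h) r m (suc j)) ∷ signature j rs (boundary (const h) r m t) h

    -- In each pass the mixed run enters block `j` in the state of the `h`-run. By equal signatures
    -- this is also the state of the constant run of `z j`, so the block is left as in both. `mz j`
    -- follows the constant run of `z j` from pass to pass; it need not start a pass in the state
    -- `m`.
    mixing : ∀ rs (z : ℕ → H) (h : H) (mz : ℕ → S) (m : S) →
             (∀ j → signature j rs (mz j) (z j) ≡ signature j rs m h) →
             passes (λ r m → boundary z r m t) rs m ≡ passes (λ r m → boundary (const h) r m t) rs m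
    mixing [] z h mz m same = refl
    mixing (r ∷ rs) z h mz m same = trans (cong (passes _ rs) (agree t))
      (mixing rs z h (λ j → boundary (const (z j)) r (mz j) t) (boundary (const h) r m t)
        (λ j → cong Vec.tail (same j)))
      where
      agree : ∀ j → boundary z r m j ≡ boundary (const h) r m j
      agree zero = refl
      agree (suc j) = begin
        op r j (z j) (boundary z r m j)                    ≡⟨ cong (op r j (z j)) (agree j) ⟩
        op r j (z j) (boundary (const h) r m j)            ≡⟨ cong (op r j (z j) ∘ proj₁ ∘ Vec.head) (same j) ⟨
        boundary (const (z j)) r (mz j) (suc j)            ≡⟨ cong (proj₂ ∘ Vec.head) (same j) ⟩
        boundary (const h) r m (suc j)                     ∎
        where open ≡-Reasoning

blocks : ∀ {H X : Set} {ℓ} → (H → Vec X ℓ) → (ℕ → H) → (t : ℕ) → Vec X (t * ℓ)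
blocks enc z zero = []
blocks enc z (suc t) = enc (z 0) Vec.++ blocks enc (z ∘ suc) t

module _ {k c t ℓ R s : ℕ} (A : Alg k (c + t * ℓ) R s) (y : Vec (Fin k) (c + t * ℓ))
         {H : Set} (enc : H → Vec (Fin k) ℓ) (pad : Vec (Fin k) c) where

  private
    n = c + t * ℓ
    S = Fin (2 ^ s)

  -- Transitions may depend on the position, so each block has its own operator, cut out of the
  -- vector of positions.
  blockOp : ∀ t → Vec (Fin n) (t * ℓ) → Fin R → ℕ → H → S → S
  blockOp zero is r j h = Function.id
  blockOp (suc t) is r zero h = run A y r (Vec.zip (Vec.take ℓ is) (enc h))
  blockOp (suc t) is r (suc j) h = blockOp t (Vec.drop ℓ is) r j h

  input : (ℕ → H) → Vec (Fin k) n
  input z = pad Vec.++ blocks enc z t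

  run-blocks : ∀ t (is : Vec (Fin n) (t * ℓ)) r z m →
               run A y r (Vec.zip is (blocks enc z t)) m ≡ states (blockOp t is r) z m t
  run-blocks zero [] r z m = refl
  run-blocks (suc t) is r z m = begin
    run A y r (Vec.zip is (enc (z 0) Vec.++ blocks enc (z ∘ suc) t)) m
      ≡⟨ run-++ A y r is (enc (z 0)) (blocks enc (z ∘ suc) t) ⟩
    run A y r (Vec.zip (Vec.drop ℓ is) (blocks enc (z ∘ suc) t)) m′
      ≡⟨ run-blocks t (Vec.drop ℓ is) r (z ∘ suc) m′ ⟩
    states (blockOp t (Vec.drop ℓ is) r) (z ∘ suc) m′ t
      ≡⟨ states-front (blockOp (suc t) is r) z m t ⟨
    states (blockOp (suc t) is r) z m (suc t) ∎
    where
    open ≡-Reasoning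
    m′ = run A y r (Vec.zip (Vec.take ℓ is) (enc (z 0))) m

  private
    op : Fin R → ℕ → H → S → S
    op = blockOp t (Vec.drop c (Vec.allFin n))

    pre : Fin R → S → S
    pre r = run A y r (Vec.zip (Vec.take c (Vec.allFin n)) pad)

  runPass≡boundary : ∀ z r m → runPass A y (input z) r m ≡ boundary op pre t z r m t
  runPass≡boundary z r m = begin
    runPass A y (input z) r m                              ≡⟨ runPass≡run A y (input z) r m ⟩
    run A y r (Vec.zip (Vec.allFin n) (input z)) m         ≡⟨ run-++ A y r (Vec.allFin n) pad (blocks enc z t) ⟩
    run A y r (Vec.zip (Vec.drop c (Vec.allFin n)) (blocks enc z t)) (pre r m)
                                                           ≡⟨ run-blocks t _ r z (pre r m) ⟩
    boundary op pre t z r m t                              ∎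
    where open ≡-Reasoning

  -- One of `(2 ^ s * 2 ^ s) ^ R` values: the memory enters the counting only through this number.
  trace : ℕ → H → Vec (S × S) (length (Vec.toList (Vec.allFin R)))
  trace j = signature op pre t j (Vec.toList (Vec.allFin R)) (Alg.init A y)

  output-mixing : ∀ (z : ℕ → H) (h : H) → (∀ j → trace j (z j) ≡ trace j h) →
                  output A y (input z) ≡ output A y (input (const h))
  output-mixing z h same = cong (Alg.out A y) (begin
    runAll A y (input z)                                        ≡⟨ total z ⟩
    passes (λ r m → boundary op pre t z r m t) rs m₀            ≡⟨ mixing op pre t rs z h (const m₀) m₀ same ⟩
    passes (λ r m → boundary op pre t (const h) r m t) rs m₀    ≡⟨ total (const h) ⟨
    runAll A y (input (const h))                                ∎)
    where
    open ≡-Reasoning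
    rs = Vec.toList (Vec.allFin R)
    m₀ = Alg.init A y
    total : ∀ z → runAll A y (input z) ≡ passes (λ r m → boundary op pre t z r m t) rs m₀
    total z = trans (runAll≡passes A y (input z)) (passes-cong (runPass≡boundary z) rs m₀)

-- Counting

private variable X Y : Set

𝟙 : Bool → ℕ
𝟙 b = if b then 1 else 0

∑ : List X → (X → ℕ) → ℕ
∑ [] f = 0
∑ (x ∷ xs) f = f x + ∑ xs f

∑< : ℕ → (ℕ → ℕ) → ℕ
∑< zero f = 0
∑< (suc n) f = f 0 + ∑< n (f ∘ suc)

∑-cong : ∀ (xs : List X) {f g} → (∀ x → f x ≡ g x) → ∑ xs f ≡ ∑ xs g
∑-cong [] f≗g = refl
∑-cong (x ∷ xs) f≗g = cong₂ _+_ (f≗g x) (∑-cong xs f≗g)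

∑-mono : ∀ (xs : List X) {f g} → (∀ x → f x ≤ g x) → ∑ xs f ≤ ∑ xs g
∑-mono [] f≤g = z≤n
∑-mono (x ∷ xs) f≤g = ℕₚ.+-mono-≤ (f≤g x) (∑-mono xs f≤g)

∑-const : ∀ (xs : List X) c → ∑ xs (const c) ≡ length xs * c
∑-const [] c = refl
∑-const (x ∷ xs) c = cong (c +_) (∑-const xs c)

∑-*ˡ : ∀ (xs : List X) c f → ∑ xs (λ x → c * f x) ≡ c * ∑ xs f
∑-*ˡ [] c f = sym (ℕₚ.*-zeroʳ c)
∑-*ˡ (x ∷ xs) c f = trans (cong (c * f x +_) (∑-*ˡ xs c f)) (sym (ℕₚ.*-distribˡ-+ c (f x) (∑ xs f)))

+-interchange : ∀ a b c d → (a + b) + (c + d) ≡ (a + c) + (b + d)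
+-interchange = solve-∀

∑-+ : ∀ (xs : List X) f g → ∑ xs (λ x → f x + g x) ≡ ∑ xs f + ∑ xs g
∑-+ [] f g = refl
∑-+ (x ∷ xs) f g = trans (cong (f x + g x +_) (∑-+ xs f g)) (+-interchange (f x) (g x) (∑ xs f) (∑ xs g))

∑-swap : ∀ (xs : List X) (ys : List Y) (f : X → Y → ℕ) → ∑ xs (λ x → ∑ ys (f x)) ≡ ∑ ys (λ y → ∑ xs (λ x → f x y))
∑-swap [] ys f = sym (trans (∑-const ys 0) (ℕₚ.*-zeroʳ (length ys)))
∑-swap (x ∷ xs) ys f = trans (cong (∑ ys (f x) +_) (∑-swap xs ys f)) (sym (∑-+ ys (f x) _))

∑<-+ : ∀ n f g → ∑< n (λ i → f i + g i) ≡ ∑< n f + ∑< n g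
∑<-+ zero f g = refl
∑<-+ (suc n) f g = trans (cong (f 0 + g 0 +_) (∑<-+ n (f ∘ suc) (g ∘ suc)))
  (+-interchange (f 0) (g 0) (∑< n (f ∘ suc)) (∑< n (g ∘ suc)))

∑<-const : ∀ n c → ∑< n (const c) ≡ n * c
∑<-const zero c = refl
∑<-const (suc n) c = cong (c +_) (∑<-const n c)

∑<-mono : ∀ n {f g} → (∀ i → f i ≤ g i) → ∑< n f ≤ ∑< n g
∑<-mono zero f≤g = z≤n
∑<-mono (suc n) f≤g = ℕₚ.+-mono-≤ (f≤g 0) (∑<-mono n (f≤g ∘ suc))

∑<-*ˡ : ∀ n c f → ∑< n (λ i → c * f i) ≡ c * ∑< n f
∑<-*ˡ zero c f = sym (ℕₚ.*-zeroʳ c)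
∑<-*ˡ (suc n) c f = trans (cong (c * f 0 +_) (∑<-*ˡ n c (f ∘ suc))) (sym (ℕₚ.*-distribˡ-+ c (f 0) _))

∑-∑<-swap : ∀ (xs : List X) n (f : X → ℕ → ℕ) → ∑ xs (λ x → ∑< n (f x)) ≡ ∑< n (λ i → ∑ xs (λ x → f x i))
∑-∑<-swap [] n f = sym (trans (∑<-const n 0) (ℕₚ.*-zeroʳ n))
∑-∑<-swap (x ∷ xs) n f = trans (cong (∑< n (f x) +_) (∑-∑<-swap xs n f)) (sym (∑<-+ n (f x) _))

∑<-window : ∀ c n m f → c + n ≤ m → ∑< n (f ∘ (c +_)) ≤ ∑< m f
∑<-window zero zero m f _ = z≤n
∑<-window zero (suc n) (suc m) f (s≤s n≤m) = ℕₚ.+-monoʳ-≤ (f 0) (∑<-window zero n m (f ∘ suc) n≤m)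
∑<-window (suc c) n (suc m) f (s≤s c+n≤m) =
  ℕₚ.≤-trans (∑<-window c n m (f ∘ suc) c+n≤m) (ℕₚ.m≤n+m _ (f 0))

+-cancel-< : ∀ {a b c d} → a + b ≤ c + d → ¬ a ≤ c → b ≤ d
+-cancel-< {a} {b} {c} {d} a+b≤c+d a≰c =
  ℕₚ.+-cancelˡ-≤ a b d (ℕₚ.≤-trans a+b≤c+d (ℕₚ.+-monoˡ-≤ d (ℕₚ.<⇒≤ (ℕₚ.≰⇒> a≰c))))

∑-average : ∀ (xs : List X) c f → 1 ≤ length xs → length xs * c ≤ ∑ xs f → ∃[ x ] c ≤ f x
∑-average (x ∷ xs) c f _ le with c ≤? f x
... | yes c≤fx = x , c≤fx
∑-average (x ∷ []) c f _ le | no c≰fx =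
  contradiction (ℕₚ.+-cancelʳ-≤ 0 c (f x) le) c≰fx
∑-average (x ∷ xs@(_ ∷ _)) c f _ le | no c≰fx = ∑-average xs c f (s≤s z≤n) (+-cancel-< le c≰fx)

∑<-average : ∀ n c f → 1 ≤ n → n * c ≤ ∑< n f → ∃[ i ] (i < n × c ≤ f i)
∑<-average (suc n) c f _ le with c ≤? f 0
... | yes c≤f0 = 0 , s≤s z≤n , c≤f0
∑<-average 1 c f _ le | no c≰f0 = contradiction (ℕₚ.+-cancelʳ-≤ 0 c (f 0) le) c≰f0
∑<-average (suc (suc n)) c f _ le | no c≰f0 =
  let i , i<n , c≤fi = ∑<-average (suc n) c (f ∘ suc) (s≤s z≤n) (+-cancel-< le c≰f0)
  in suc i , s≤s i<n , c≤fi

∑-∈ : ∀ {xs : List X} {x} f → x ∈ xs → f x ≤ ∑ xs f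
∑-∈ f (here refl) = ℕₚ.m≤m+n _ _
∑-∈ {xs = x ∷ _} f (there x∈xs) = ℕₚ.≤-trans (∑-∈ f x∈xs) (ℕₚ.m≤n+m _ (f x))

length-filter : ∀ {P : X → Set} (P? : ∀ x → Dec (P x)) xs → length (filter P? xs) ≡ ∑ xs (λ x → 𝟙 (does (P? x)))
length-filter P? [] = refl
length-filter P? (x ∷ xs) with P? x
... | yes _ = cong suc (length-filter P? xs)
... | no  _ = length-filter P? xs

unique-⊆⇒length≤ : ∀ {xs ys : List X} → Unique xs → (∀ {x} → x ∈ xs → x ∈ ys) → length xs ≤ length ys
unique-⊆⇒length≤ [] _ = z≤n
unique-⊆⇒length≤ {X = X} {xs = x ∷ xs} (x∉xs ∷ xs!) xs⊆ys with ∈ₚ.∈-∃++ (xs⊆ys (here refl))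
... | as , bs , refl = ℕₚ.≤-trans (s≤s (unique-⊆⇒length≤ xs! rest)) (ℕₚ.≤-reflexive len)
  where
  rest : ∀ {u} → u ∈ xs → u ∈ as ++ bs
  rest u∈xs with ∈ₚ.∈-++⁻ as (xs⊆ys (there u∈xs))
  ... | inj₁ u∈as = ∈ₚ.∈-++⁺ˡ u∈as
  ... | inj₂ (here refl) = contradiction refl (All.lookup x∉xs u∈xs)
  ... | inj₂ (there u∈bs) = ∈ₚ.∈-++⁺ʳ as u∈bs
  len : suc (length (as ++ bs)) ≡ length (as ++ x ∷ bs)
  len = trans (cong suc (Listₚ.length-++ as)) (trans (sym (ℕₚ.+-suc (length as) (length bs))) (sym (Listₚ.length-++ as)))

length-cartesianProductWith : ∀ {X Y Z : Set} (f : X → Y → Z) xs ys →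
  length (List.cartesianProductWith f xs ys) ≡ length xs * length ys
length-cartesianProductWith f [] ys = refl
length-cartesianProductWith f (x ∷ xs) ys =
  trans (Listₚ.length-++ (List.map (f x) ys))
        (cong₂ _+_ (Listₚ.length-map (f x) ys) (length-cartesianProductWith f xs ys))

-- Products of lists serve twice: as the space of hidden words, and as a box around a class of
-- words, one factor per coordinate, that bounds the size of the class.
choices : ∀ {m} → (Fin m → List X) → List (Vec X m)
choices {m = zero} U = [] ∷ []
choices {m = suc m} U = List.cartesianProductWith _∷_ (U zero) (choices (U ∘ suc))

choices-complete : ∀ {m} (U : Fin m → List X) v → (∀ i → Vec.lookup v i ∈ U i) → v ∈ choices U
choices-complete U [] _ = here refl
choices-complete U (x ∷ v) v∈U =
  ∈ₚ.∈-cartesianProductWith⁺ _∷_ (v∈U zero) (choices-complete (U ∘ suc) v (v∈U ∘ suc))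

choices-unique : ∀ {m} {U : Fin m → List X} → (∀ i → Unique (U i)) → Unique (choices U)
choices-unique {m = zero} U! = [] ∷ []
choices-unique {m = suc m} U! =
  Uniqueₚ.cartesianProductWith⁺ _∷_ (λ { refl → refl , refl }) (U! zero) (choices-unique (U! ∘ suc))

length-choices-const : ∀ m (U : List X) → length (choices {m = m} (const U)) ≡ length U ^ m
length-choices-const zero U = refl
length-choices-const (suc m) U =
  trans (length-cartesianProductWith _∷_ U _) (cong (length U *_) (length-choices-const m U))

-- Averaging over hidden words, blocks and diagonals

module _ {H V : Set} (_≟_ : DecidableEquality V) (hs : List H) (f : H → V)
         (vs : List V) (f∈vs : ∀ h → f h ∈ vs) (B : ℕ) where

  fibre : V → List H
  fibre v = filter (λ z → f z ≟ v) hs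

  isSmall : V → Bool
  isSmall v = does (length (fibre v) ≤? B)

  -- Each value in `vs` whose fibre is small accounts for at most `B` elements of `hs`.
  small-fibres : ∑ hs (λ h → 𝟙 (isSmall (f h))) ≤ length vs * B
  small-fibres = begin
    ∑ hs (λ h → 𝟙 (isSmall (f h)))                                  ≤⟨ ∑-mono hs pointwise ⟩
    ∑ hs (λ h → ∑ vs (λ v → 𝟙 (isSmall v) * 𝟙 (does (f h ≟ v))))  ≡⟨ ∑-swap hs vs _ ⟩
    ∑ vs (λ v → ∑ hs (λ h → 𝟙 (isSmall v) * 𝟙 (does (f h ≟ v))))  ≤⟨ ∑-mono vs fibrewise ⟩
    ∑ vs (const B)                                                   ≡⟨ ∑-const vs B ⟩
    length vs * B                                                    ∎
    where
    open ℕₚ.≤-Reasoning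
    pointwise : ∀ h → 𝟙 (isSmall (f h)) ≤ ∑ vs (λ v → 𝟙 (isSmall v) * 𝟙 (does (f h ≟ v)))
    pointwise h with ∑-∈ (λ v → 𝟙 (isSmall v) * 𝟙 (does (f h ≟ v))) (f∈vs h)
    ... | le with f h ≟ f h
    ... | yes _ = ℕₚ.≤-trans (ℕₚ.≤-reflexive (sym (ℕₚ.*-identityʳ (𝟙 (isSmall (f h)))))) le
    ... | no ¬p = contradiction refl ¬p
    fibrewise : ∀ v → ∑ hs (λ h → 𝟙 (isSmall v) * 𝟙 (does (f h ≟ v))) ≤ B
    fibrewise v rewrite ∑-*ˡ hs (𝟙 (isSmall v)) (λ h → 𝟙 (does (f h ≟ v)))
                      | sym (length-filter (λ z → f z ≟ v) hs) = capped (length (fibre v) ≤? B)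
      where
      capped : ∀ {n} (n≤B? : Dec (n ≤ B)) → 𝟙 (does n≤B?) * n ≤ B
      capped (yes n≤B) = subst (_≤ B) (sym (ℕₚ.+-identityʳ _)) n≤B
      capped (no _) = z≤n

module _ {H V : Set} (_≟_ : DecidableEquality V) (hs : List H) (f : ℕ → H → V)
         (vs : List V) (f∈vs : ∀ j h → f j h ∈ vs) (B K : ℕ)
         (g : ℕ → H → Fin K → Bool)
         (sparse⇒small : ∀ j h → 2 * ∑ (allFin K) (λ a → 𝟙 (g j h a)) < K →
                         length (fibre _≟_ hs (f j) vs (f∈vs j) B (f j h)) ≤ B)
         (few : 4 * (length vs * B) ≤ length hs) (hs≢[] : 1 ≤ length hs) (1≤K : 1 ≤ K) where

  private
    N D : ℕ
    N = length hs
    D = 3 * K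

    -- In the application, `g j h a` says that some substitute for `h` at block `j` deviates at
    -- index `a`. The shift to `suc j` aims at the middle block of a triple.
    G : ℕ → H → ℕ
    G j h = ∑ (allFin K) (λ a → 𝟙 (g (suc j) h a))

    -- At most a quarter of `hs` lies in small fibres, by `few`; any other `h` has at least K/2 good
    -- indices, by `sparse⇒small`. The mean over `h` is therefore at least 3K/8.
    dense : ∀ j → N * (3 * K) ≤ 8 * ∑ hs (G j)
    dense j = ℕₚ.+-cancelʳ-≤ (N * K) _ _ (begin
      N * (3 * K) + N * K                         ≡⟨ e₁ N K ⟩
      4 * (N * K)                                 ≡⟨ cong (4 *_) (∑-const hs K) ⟨
      4 * ∑ hs (const K)                          ≤⟨ ℕₚ.*-monoʳ-≤ 4 (∑-mono hs pointwise) ⟩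
      4 * ∑ hs (λ h → 2 * G j h + K * small h)    ≡⟨ cong (4 *_) (trans (∑-+ hs _ _) (cong₂ _+_ (∑-*ˡ hs 2 (G j)) (∑-*ˡ hs K small))) ⟩
      4 * (2 * ∑ hs (G j) + K * ∑ hs small)       ≤⟨ ℕₚ.*-monoʳ-≤ 4 (ℕₚ.+-monoʳ-≤ (2 * ∑ hs (G j)) (ℕₚ.*-monoʳ-≤ K few-small)) ⟩
      4 * (2 * ∑ hs (G j) + K * (length vs * B))  ≡⟨ e₂ (∑ hs (G j)) K (length vs * B) ⟩
      8 * ∑ hs (G j) + K * (4 * (length vs * B))  ≤⟨ ℕₚ.+-monoʳ-≤ (8 * ∑ hs (G j)) (ℕₚ.*-monoʳ-≤ K few) ⟩
      8 * ∑ hs (G j) + K * N                      ≡⟨ cong (8 * ∑ hs (G j) +_) (ℕₚ.*-comm K N) ⟩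
      8 * ∑ hs (G j) + N * K                      ∎)
      where
      open ℕₚ.≤-Reasoning
      small : H → ℕ
      small h = 𝟙 (isSmall _≟_ hs (f (suc j)) vs (f∈vs (suc j)) B (f (suc j) h))
      few-small = small-fibres _≟_ hs (f (suc j)) vs (f∈vs (suc j)) B
      e₁ : ∀ N K → N * (3 * K) + N * K ≡ 4 * (N * K)
      e₁ = solve-∀
      e₂ : ∀ g K m → 4 * (2 * g + K * m) ≡ 8 * g + K * (4 * m)
      e₂ = solve-∀
      pointwise : ∀ h → K ≤ 2 * G j h + K * small h
      pointwise h = cases (length (fibre _≟_ hs (f (suc j)) vs (f∈vs (suc j)) B (f (suc j) h)) ≤? B)
                          (sparse⇒small (suc j) h)
        where
        cases : ∀ {n} (n≤B? : Dec (n ≤ B)) → (2 * G j h < K → n ≤ B) → K ≤ 2 * G j h + K * 𝟙 (does n≤B?)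
        cases (yes _) _ = ℕₚ.≤-trans (ℕₚ.≤-reflexive (sym (ℕₚ.*-identityʳ K))) (ℕₚ.m≤n+m _ (2 * G j h))
        cases (no large) sparse = ℕₚ.≤-trans (ℕₚ.≮⇒≥ (large ∘ sparse)) (ℕₚ.m≤m+n _ _)

    Diagonal : H → ℕ → ℕ
    Diagonal h σ = ∑ (allFin K) (λ a → 𝟙 (g (suc (3 * toℕ a + σ)) h a))

    3a≤D : ∀ (a : Fin K) → 3 * toℕ a ≤ D
    3a≤D a = ℕₚ.*-monoʳ-≤ 3 (ℕₚ.<⇒≤ (Finₚ.toℕ<n a))

    -- Since 3a ≤ D, the entry of index `a` in row `D + i` lies on the diagonal D + i - 3a, which is
    -- at least 0 and below 2D. This is why the rows start at `D`.
    rows≤diagonals : ∀ h → ∑< D (λ i → G (D + i) h) ≤ ∑< (2 * D) (Diagonal h)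
    rows≤diagonals h = begin
      ∑< D (λ i → ∑ (allFin K) (λ a → b a (D + i)))                 ≡⟨ ∑-∑<-swap (allFin K) D (λ a i → b a (D + i)) ⟨
      ∑ (allFin K) (λ a → ∑< D (λ i → b a (D + i)))                 ≤⟨ ∑-mono (allFin K) window ⟩
      ∑ (allFin K) (λ a → ∑< (2 * D) (λ σ → b a (3 * toℕ a + σ)))   ≡⟨ ∑-∑<-swap (allFin K) (2 * D) _ ⟩
      ∑< (2 * D) (Diagonal h)                                       ∎
      where
      open ℕₚ.≤-Reasoning
      b : Fin K → ℕ → ℕ
      b a j = 𝟙 (g (suc j) h a)
      window : ∀ a → ∑< D (λ i → b a (D + i)) ≤ ∑< (2 * D) (λ σ → b a (3 * toℕ a + σ))
      window a = begin
        ∑< D (λ i → b a (D + i))                            ≤⟨ ∑<-mono D (λ i → ℕₚ.≤-reflexive (cong (b a) (shift i))) ⟩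
        ∑< D (λ i → b a (3 * toℕ a + (D ∸ 3 * toℕ a + i)))  ≤⟨ ∑<-window (D ∸ 3 * toℕ a) D (2 * D) _ bound ⟩
        ∑< (2 * D) (λ σ → b a (3 * toℕ a + σ))              ∎
        where
        shift : ∀ i → D + i ≡ 3 * toℕ a + (D ∸ 3 * toℕ a + i)
        shift i = trans (cong (_+ i) (sym (ℕₚ.m+[n∸m]≡n (3a≤D a)))) (ℕₚ.+-assoc (3 * toℕ a) _ i)
        bound : D ∸ 3 * toℕ a + D ≤ 2 * D
        bound = ℕₚ.+-mono-≤ (ℕₚ.m∸n≤m D (3 * toℕ a)) (ℕₚ.≤-reflexive (sym (ℕₚ.+-identityʳ D)))

  -- Averaging over `h` fixes one word whose `D` rows hold 3K/8 entries each on average. They spread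
  -- over `2 * D` diagonals, so one of these keeps half of that, 3K/16.
  dense-diagonal : ∃[ h ] ∃[ σ ] (σ < 6 * K ×
    3 * K ≤ 16 * ∑ (allFin K) (λ a → 𝟙 (g (suc (3 * toℕ a + σ)) h a)))
  dense-diagonal =
    let h , le = ∑-average hs (D * (3 * K)) (λ h → 8 * ∑< D (λ i → G (D + i) h)) hs≢[] sum-rows
        σ , σ<2D , le′ = ∑<-average (2 * D) (3 * K) (λ σ → 16 * Diagonal h σ) 1≤2D (sum-diagonals h le)
    in h , σ , subst (σ <_) (sym (ℕₚ.*-assoc 2 3 K)) σ<2D , le′
    where
    open ℕₚ.≤-Reasoning
    1≤2D : 1 ≤ 2 * D
    1≤2D = ℕₚ.*-mono-≤ {1} {2} (s≤s z≤n) (ℕₚ.*-mono-≤ {1} {3} (s≤s z≤n) 1≤K)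
    sum-rows : N * (D * (3 * K)) ≤ ∑ hs (λ h → 8 * ∑< D (λ i → G (D + i) h))
    sum-rows = begin
      N * (D * (3 * K))                            ≡⟨ e N D (3 * K) ⟩
      D * (N * (3 * K))                            ≡⟨ ∑<-const D _ ⟨
      ∑< D (const (N * (3 * K)))                   ≤⟨ ∑<-mono D (λ i → dense (D + i)) ⟩
      ∑< D (λ i → 8 * ∑ hs (G (D + i)))            ≡⟨ ∑<-*ˡ D 8 _ ⟩
      8 * ∑< D (λ i → ∑ hs (G (D + i)))            ≡⟨ cong (8 *_) (∑-∑<-swap hs D (λ h i → G (D + i) h)) ⟨
      8 * ∑ hs (λ h → ∑< D (λ i → G (D + i) h))    ≡⟨ ∑-*ˡ hs 8 _ ⟨
      ∑ hs (λ h → 8 * ∑< D (λ i → G (D + i) h))    ∎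
      where
      e : ∀ N D c → N * (D * c) ≡ D * (N * c)
      e = solve-∀
    sum-diagonals : ∀ h → D * (3 * K) ≤ 8 * ∑< D (λ i → G (D + i) h) →
                    2 * D * (3 * K) ≤ ∑< (2 * D) (λ σ → 16 * Diagonal h σ)
    sum-diagonals h le = begin
      2 * D * (3 * K)                        ≡⟨ ℕₚ.*-assoc 2 D (3 * K) ⟩
      2 * (D * (3 * K))                      ≤⟨ ℕₚ.*-monoʳ-≤ 2 le ⟩
      2 * (8 * ∑< D (λ i → G (D + i) h))     ≤⟨ ℕₚ.*-monoʳ-≤ 2 (ℕₚ.*-monoʳ-≤ 8 {∑< D (λ i → G (D + i) h)} (rows≤diagonals h)) ⟩
      2 * (8 * ∑< (2 * D) (Diagonal h))      ≡⟨ ℕₚ.*-assoc 2 8 (∑< (2 * D) (Diagonal h)) ⟨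
      16 * ∑< (2 * D) (Diagonal h)           ≡⟨ ∑<-*ˡ (2 * D) 16 _ ⟨
      ∑< (2 * D) (λ σ → 16 * Diagonal h σ)   ∎

-- Unnoticed deviations

length-toList : ∀ {X : Set} {m} (v : Vec X m) → length (Vec.toList v) ≡ m
length-toList [] = refl
length-toList (x ∷ v) = cong suc (length-toList v)

power : ∀ {X : Set} → ℕ → List X → List X
power zero w = []
power (suc t) w = w ++ power t w

module _ {H : Set} (h : H) where

  delay : ℕ → (ℕ → H) → ℕ → H
  delay zero z j = z j
  delay (suc σ) z zero = h
  delay (suc σ) z (suc j) = delay σ z j

  -- Each deviation has an unchanged block on both sides, because the gain of a binary gadget may
  -- need `h` before it or after it.
  triples : ∀ {m} → (Fin m → H) → ℕ → H
  triples {zero} w j = h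
  triples {suc m} w 0 = h
  triples {suc m} w 1 = w zero
  triples {suc m} w 2 = h
  triples {suc m} w (suc (suc (suc j))) = triples (w ∘ suc) j

  delay-all : ∀ σ z (P : ℕ → H → Set) → (∀ j → P j h) → (∀ j → P (j + σ) (z j)) → ∀ j → P j (delay σ z j)
  delay-all zero z P Ph Pz j = subst (λ i → P i (z j)) (ℕₚ.+-identityʳ j) (Pz j)
  delay-all (suc σ) z P Ph Pz zero = Ph 0
  delay-all (suc σ) z P Ph Pz (suc j) = delay-all σ z (P ∘ suc) (Ph ∘ suc)
    (λ i → subst (λ n → P n (z i)) (ℕₚ.+-suc i σ) (Pz i)) j

  triples-all : ∀ {m} (w : Fin m → H) (P : ℕ → H → Set) → (∀ j → P j h) →
                (∀ i → P (suc (3 * toℕ i)) (w i)) → ∀ j → P j (triples w j)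
  triples-all {zero} w P Ph Pw j = Ph j
  triples-all {suc m} w P Ph Pw 0 = Ph 0
  triples-all {suc m} w P Ph Pw 1 = Pw zero
  triples-all {suc m} w P Ph Pw 2 = Ph 2
  triples-all {suc m} w P Ph Pw (suc (suc (suc j))) = triples-all (w ∘ suc) (P ∘ (3 +_)) (Ph ∘ (3 +_))
    (λ i → subst (λ n → P (suc n) (w (suc i))) (ℕₚ.*-suc 3 (toℕ i)) (Pw (suc i))) j

module _ {H X : Set} {ℓ : ℕ} (enc : H → Vec X ℓ) where

  word : H → List X
  word = Vec.toList ∘ enc

  toList-blocks-suc : ∀ z t → Vec.toList (blocks enc z (suc t)) ≡ word (z 0) ++ Vec.toList (blocks enc (z ∘ suc) t)
  toList-blocks-suc z t = Vecₚ.toList-++ (enc (z 0)) _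

  toList-blocks-const : ∀ h t → Vec.toList (blocks enc (const h) t) ≡ power t (word h)
  toList-blocks-const h zero = refl
  toList-blocks-const h (suc t) = trans (toList-blocks-suc (const h) t) (cong (word h ++_) (toList-blocks-const h t))

  toList-blocks-delay : ∀ h σ z t → Vec.toList (blocks enc (delay h σ z) (σ + t)) ≡
                        power σ (word h) ++ Vec.toList (blocks enc z t)
  toList-blocks-delay h zero z t = refl
  toList-blocks-delay h (suc σ) z t = begin
    Vec.toList (blocks enc (delay h (suc σ) z) (suc σ + t))        ≡⟨ toList-blocks-suc (delay h (suc σ) z) (σ + t) ⟩
    word h ++ Vec.toList (blocks enc (delay h σ z) (σ + t))        ≡⟨ cong (word h ++_) (toList-blocks-delay h σ z t) ⟩
    word h ++ (power σ (word h) ++ Vec.toList (blocks enc z t))    ≡⟨ Listₚ.++-assoc (word h) _ _ ⟨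
    power (suc σ) (word h) ++ Vec.toList (blocks enc z t)          ∎
    where open ≡-Reasoning

  triple : H → H → List X
  triple h w = word h ++ word w ++ word h

  toList-blocks-triples : ∀ h {m} (w : Fin m → H) t → Vec.toList (blocks enc (triples h w) (m * 3 + t)) ≡
                          concat (tabulate (triple h ∘ w)) ++ power t (word h)
  toList-blocks-triples h {zero} w t = toList-blocks-const h t
  toList-blocks-triples h {suc m} w t = begin
    Vec.toList (blocks enc z (3 + m * 3 + t))
      ≡⟨ toList-blocks-suc z (2 + m * 3 + t) ⟩
    word h ++ Vec.toList (blocks enc (z ∘ suc) (2 + m * 3 + t))
      ≡⟨ cong (word h ++_) (toList-blocks-suc (z ∘ suc) (1 + m * 3 + t)) ⟩
    word h ++ word (w zero) ++ Vec.toList (blocks enc (z ∘ (2 +_)) (1 + m * 3 + t))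
      ≡⟨ cong (λ l → word h ++ word (w zero) ++ l) (toList-blocks-suc (z ∘ (2 +_)) (m * 3 + t)) ⟩
    word h ++ word (w zero) ++ word h ++ Vec.toList (blocks enc (triples h (w ∘ suc)) (m * 3 + t))
      ≡⟨ cong (λ l → word h ++ word (w zero) ++ word h ++ l) (toList-blocks-triples h (w ∘ suc) t) ⟩
    word h ++ word (w zero) ++ word h ++ rest ++ power t (word h)
      ≡⟨ reassoc (word h) (word (w zero)) (word h) rest (power t (word h)) ⟩
    (triple h (w zero) ++ rest) ++ power t (word h) ∎
    where
    open ≡-Reasoning
    z = triples h w
    rest = concat (tabulate (triple h ∘ w ∘ suc))
    reassoc : (a b c d e : List X) → a ++ b ++ c ++ d ++ e ≡ ((a ++ b ++ c) ++ d) ++ e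
    reassoc a b c d e = begin
      a ++ b ++ c ++ d ++ e          ≡⟨ cong (λ l → a ++ b ++ l) (Listₚ.++-assoc c d e) ⟨
      a ++ b ++ (c ++ d) ++ e        ≡⟨ cong (a ++_) (Listₚ.++-assoc b (c ++ d) e) ⟨
      a ++ (b ++ c ++ d) ++ e        ≡⟨ Listₚ.++-assoc a (b ++ c ++ d) e ⟨
      (a ++ b ++ c ++ d) ++ e        ≡⟨ cong (λ l → (a ++ l) ++ e) (Listₚ.++-assoc b c d) ⟨
      (a ++ (b ++ c) ++ d) ++ e      ≡⟨ cong (_++ e) (Listₚ.++-assoc a (b ++ c) d) ⟨
      ((a ++ b ++ c) ++ d) ++ e      ∎

-- All that the two regimes take from the counting: a constant input and a deviating one that the
-- algorithm cannot tell apart. With t = 9K, the blocks split into σ constant ones, K triples and 6K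
-- - σ constant ones.
record Confusion {k c t K ℓ R s : ℕ} (A : Alg k (c + t * ℓ) R s) (y : Vec (Fin k) (c + t * ℓ))
                 {H : Set} (enc : H → Vec (Fin k) ℓ) (pad : Vec (Fin k) c)
                 {Q : H → H → Fin K → Set} (Q? : ∀ h w a → Dec (Q h w a)) : Set where
  field
    h : H
    σ : ℕ
    v : Fin K → H
    x₀ x₁ : Vec (Fin k) (c + t * ℓ)
    σ≤6K : σ ≤ 6 * K
    many : 3 * K ≤ 16 * ∑ (allFin K) (λ a → 𝟙 (does (Q? h (v a) a)))
    same-output : output A y x₁ ≡ output A y x₀
    x₀-form : Vec.toList x₀ ≡ Vec.toList pad ++ power t (word enc h)
    x₁-form : Vec.toList x₁ ≡ Vec.toList pad ++ power σ (word enc h) ++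
              concat (tabulate (triple enc h ∘ v)) ++ power (6 * K ∸ σ) (word enc h)

module _ {k c t K ℓ R s : ℕ} (t≡9K : t ≡ 9 * K) (A : Alg k (c + t * ℓ) R s) (y : Vec (Fin k) (c + t * ℓ))
         {H : Set} (enc : H → Vec (Fin k) ℓ) (pad : Vec (Fin k) c)
         (hs : List H) (hs! : Unique hs) (hs≢[] : 1 ≤ length hs) (1≤K : 1 ≤ K)
         {Q : H → H → Fin K → Set} (Q? : ∀ h w a → Dec (Q h w a)) (B : ℕ)
         (sparse⇒small : ∀ C → Unique C → ∀ h →
           2 * ∑ (allFin K) (λ a → 𝟙 (does (any? (λ w → Q? h w a) C))) < K → length C ≤ B)
         (few : 4 * ((2 ^ s * 2 ^ s) ^ R * B) ≤ length hs) where

  private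
    n = c + t * ℓ
    S = Fin (2 ^ s)
    R′ = length (Vec.toList (Vec.allFin R))
    V = Vec (S × S) R′

    tr : ℕ → H → V
    tr = trace {c = c} {t = t} A y enc pad

    _≟_ : DecidableEquality V
    _≟_ = Vecₚ.≡-dec (×ₚ.≡-dec Finₚ._≟_ Finₚ._≟_)

    pairs : List (S × S)
    pairs = List.cartesianProductWith _,_ (allFin (2 ^ s)) (allFin (2 ^ s))

    vs : List V
    vs = choices (const pairs)

    tr∈vs : ∀ j h → tr j h ∈ vs
    tr∈vs j h = choices-complete (const pairs) (tr j h)
      (λ i → ∈ₚ.∈-cartesianProductWith⁺ _,_ (∈ₚ.∈-allFin _) (∈ₚ.∈-allFin _))

    length-vs : length vs ≡ (2 ^ s * 2 ^ s) ^ R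
    length-vs = begin
      length vs               ≡⟨ length-choices-const R′ pairs ⟩
      length pairs ^ R′       ≡⟨ cong₂ _^_ (length-cartesianProductWith _,_ (allFin (2 ^ s)) (allFin (2 ^ s)))
                                           (length-toList (Vec.allFin R)) ⟩
      (length (allFin (2 ^ s)) * length (allFin (2 ^ s))) ^ R
                              ≡⟨ cong (λ l → (l * l) ^ R) (Listₚ.length-tabulate {n = 2 ^ s} Function.id) ⟩
      (2 ^ s * 2 ^ s) ^ R     ∎
      where open ≡-Reasoning

    class : ℕ → H → List H
    class j h = fibre _≟_ hs (tr j) vs (tr∈vs j) B (tr j h)

    good? : ∀ j h a → Dec (Any (λ w → Q h w a) (class j h))
    good? j h a = any? (λ w → Q? h w a) (class j h)

    witness : ∀ j h a → H
    witness j h a with good? j h a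
    ... | yes w = proj₁ (find w)
    -- If no substitute deviates at `a`, the block keeps `h`, which has the required trace.
    ... | no _ = h

    witness-same : ∀ j h a → tr j (witness j h a) ≡ tr j h
    witness-same j h a with good? j h a
    ... | yes w = proj₂ (∈ₚ.∈-filter⁻ (λ z → tr j z ≟ tr j h) {xs = hs} (proj₁ (proj₂ (find w))))
    ... | no _ = refl

    witness-good : ∀ j h a → 𝟙 (does (good? j h a)) ≤ 𝟙 (does (Q? h (witness j h a) a))
    witness-good j h a with good? j h a
    ... | yes w = ℕₚ.≤-reflexive (cong 𝟙 (sym (dec-true (Q? h _ a) (proj₂ (proj₂ (find w))))))
    ... | no _ = z≤n

  confusion : Confusion {c = c} {t = t} A y enc pad Q?
  confusion = build (dense-diagonal _≟_ hs tr vs tr∈vs B K (λ j h a → does (good? j h a))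
                      (λ j h → sparse⇒small (class j h) (Uniqueₚ.filter⁺ _ hs!) h)
                      (subst (λ M → 4 * (M * B) ≤ length hs) (sym length-vs) few) hs≢[] 1≤K)
    where
    module _ (h : H) (σ : ℕ) (σ<6K : σ < 6 * K) where
      w : Fin K → H
      w a = witness (suc (3 * toℕ a + σ)) h a
      z : ℕ → H
      z = delay h σ (triples h w)
      σ≤6K = ℕₚ.<⇒≤ σ<6K
      length-form : t ≡ σ + (K * 3 + (6 * K ∸ σ))
      length-form = begin
        t                                ≡⟨ t≡9K ⟩
        9 * K                            ≡⟨ e K ⟩
        K * 3 + 6 * K                    ≡⟨ cong (K * 3 +_) (ℕₚ.m+[n∸m]≡n σ≤6K) ⟨
        K * 3 + (σ + (6 * K ∸ σ))        ≡⟨ e′ (K * 3) σ (6 * K ∸ σ) ⟩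
        σ + (K * 3 + (6 * K ∸ σ))        ∎
        where
        open ≡-Reasoning
        e : ∀ K → 9 * K ≡ K * 3 + 6 * K
        e = solve-∀
        e′ : ∀ a b c → a + (b + c) ≡ b + (a + c)
        e′ = solve-∀
      z-form : Vec.toList (blocks enc z t) ≡
               power σ (word enc h) ++ concat (tabulate (triple enc h ∘ w)) ++ power (6 * K ∸ σ) (word enc h)
      z-form = trans (cong (λ t → Vec.toList (blocks enc z t)) length-form)
        (trans (toList-blocks-delay enc h σ (triples h w) _)
               (cong (power σ (word enc h) ++_) (toList-blocks-triples enc h w (6 * K ∸ σ))))
      z-same : ∀ j → tr j (z j) ≡ tr j h
      z-same = delay-all h σ (triples h w) (λ j v → tr j v ≡ tr j h) (λ _ → refl)
        (triples-all h w (λ j v → tr (j + σ) v ≡ tr (j + σ) h) (λ _ → refl) (λ a → witness-same _ h a))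
    build : ∃[ h ] ∃[ σ ] (σ < 6 * K ×
              3 * K ≤ 16 * ∑ (allFin K) (λ a → 𝟙 (does (good? (suc (3 * toℕ a + σ)) h a)))) → Confusion {c = c} {t = t} A y enc pad Q?
    build (h , σ , σ<6K , many) = record
      { h = h ; σ = σ ; v = w h σ σ<6K
      ; x₀ = input {c = c} {t = t} A y enc pad (const h)
      ; x₁ = input {c = c} {t = t} A y enc pad (z h σ σ<6K)
      ; σ≤6K = σ≤6K h σ σ<6K
      ; many = ℕₚ.≤-trans many (ℕₚ.*-monoʳ-≤ 16 (∑-mono (allFin K) (λ a → witness-good _ h a)))
      ; same-output = output-mixing {c = c} {t = t} A y enc pad (z h σ σ<6K) h (z-same h σ σ<6K)
      ; x₀-form = trans (Vecₚ.toList-++ pad _) (cong (Vec.toList pad ++_) (toList-blocks-const enc h t))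
      ; x₁-form = trans (Vecₚ.toList-++ pad _) (cong (Vec.toList pad ++_) (z-form h σ σ<6K))
      }

-- Longest common subsequences and the approximation ratio

module _ {X : Set} (_≟_ : DecidableEquality X) where

  private
    drop-head : ∀ {c : X} {z x} → c ∷ z ⊆ x → z ⊆ x
    drop-head (_ ∷ʳ p) = _ ∷ʳ drop-head p
    drop-head (_ ∷ p) = _ ∷ʳ p

    lcs-step : ∀ {a b x y} → Dec (a ≡ b) → ∃[ m ] IsLCS x y m → ∃[ m ] IsLCS x (b ∷ y) m →
               ∃[ m ] IsLCS (a ∷ x) y m → ∃[ m ] IsLCS (a ∷ x) (b ∷ y) m
    lcs-step {a} {x = x} {y} (yes refl) (m , (z , (z⊆x , z⊆y) , eq) , max) _ _ =
      suc m , (a ∷ z , (refl ∷ z⊆x , refl ∷ z⊆y) , cong suc eq) , bound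
      where
      bound : ∀ z → CommonSubseq z (a ∷ x) (a ∷ y) → length z ≤ suc m
      bound z (_ ∷ʳ p , _ ∷ʳ q) = ℕₚ.m≤n⇒m≤1+n (max z (p , q))
      bound (_ ∷ z) (_ ∷ p , _ ∷ q) = s≤s (max z (p , q))
      bound (_ ∷ z) (_ ∷ʳ p , _ ∷ q) = s≤s (max z (drop-head p , q))
      bound (_ ∷ z) (_ ∷ p , _ ∷ʳ q) = s≤s (max z (p , drop-head q))
    lcs-step (no a≢b) _ (m , (z , (z⊆x , z⊆y) , eq) , max) (m′ , (z′ , (z′⊆x , z′⊆y) , eq′) , max′)
      with ℕₚ.≤-total m m′
    ... | inj₁ m≤m′ = m′ , (z′ , (z′⊆x , _ ∷ʳ z′⊆y) , eq′) , λ
      { u (_ ∷ʳ p , q) → ℕₚ.≤-trans (max u (p , q)) m≤m′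
      ; u (p@(_ ∷ _) , _ ∷ʳ q) → max′ u (p , q)
      ; (c ∷ u) (c≡a ∷ p , c≡b ∷ q) → contradiction (trans (sym c≡a) c≡b) a≢b }
    ... | inj₂ m′≤m = m , (z , (_ ∷ʳ z⊆x , z⊆y) , eq) , λ
      { u (_ ∷ʳ p , q) → max u (p , q)
      ; u (p@(_ ∷ _) , _ ∷ʳ q) → ℕₚ.≤-trans (max′ u (p , q)) m′≤m
      ; (c ∷ u) (c≡a ∷ p , c≡b ∷ q) → contradiction (trans (sym c≡a) c≡b) a≢b }

  -- `Approximates` constrains the output only at a number certified by `IsLCS`, so exact values
  -- have to be produced before it can be applied.
  lcs-exists : ∀ (x y : List X) → ∃[ m ] IsLCS x y m
  lcs-exists [] y = 0 , ([] , ([] , minimum y) , refl) , λ { [] _ → z≤n }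
  lcs-exists (a ∷ x) [] = 0 , ([] , (minimum _ , []) , refl) , λ { [] _ → z≤n }
  lcs-exists (a ∷ x) (b ∷ y) =
    lcs-step (a ≟ b) (lcs-exists x y) (lcs-exists x (b ∷ y)) (lcs-exists (a ∷ x) y)

module _ where
  open import Data.Integer using (+_)

  toℚᵘ-/ : ∀ n d → toℚᵘ (+ n ℚ./ suc d) ℚᵘ.≃ mkℚᵘ (+ n) d
  toℚᵘ-/ n d = ℚₚ.toℚᵘ-fromℚᵘ (mkℚᵘ (+ n) d)

  toℕ-≤ : ∀ {a b} → + a ℤ.≤ + b → a ≤ b
  toℕ-≤ (ℤ.+≤+ a≤b) = a≤b

  module _ (ε : ℚ) (p d : ℕ) (ε≡p/d : toℚᵘ ε ≡ mkℚᵘ (+ p) d) where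

    ≤-scaled : ∀ a b → ⟦ a ⟧ ℚ.≤ (1ℚ ℚ.+ ε) ℚ.* ⟦ b ⟧ → a * suc d ≤ (suc d + p) * b
    ≤-scaled a b le = toℕ-≤ (subst₂ ℤ._≤_ l r (ℚᵘₚ.drop-*≤* le′))
      where
      le′ : mkℚᵘ (+ a) 0 ℚᵘ.≤ (ℚᵘ.1ℚᵘ ℚᵘ.+ mkℚᵘ (+ p) d) ℚᵘ.* mkℚᵘ (+ b) 0
      le′ = begin
        mkℚᵘ (+ a) 0                                           ≃⟨ toℚᵘ-/ a 0 ⟨
        toℚᵘ ⟦ a ⟧                                             ≤⟨ ℚₚ.toℚᵘ-mono-≤ le ⟩
        toℚᵘ ((1ℚ ℚ.+ ε) ℚ.* ⟦ b ⟧)                            ≃⟨ ℚₚ.toℚᵘ-homo-* (1ℚ ℚ.+ ε) ⟦ b ⟧ ⟩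
        toℚᵘ (1ℚ ℚ.+ ε) ℚᵘ.* toℚᵘ ⟦ b ⟧                        ≃⟨ ℚᵘₚ.*-cong (ℚₚ.toℚᵘ-homo-+ 1ℚ ε) (toℚᵘ-/ b 0) ⟩
        (ℚᵘ.1ℚᵘ ℚᵘ.+ toℚᵘ ε) ℚᵘ.* mkℚᵘ (+ b) 0                 ≡⟨ cong (λ e → (ℚᵘ.1ℚᵘ ℚᵘ.+ e) ℚᵘ.* mkℚᵘ (+ b) 0) ε≡p/d ⟩
        (ℚᵘ.1ℚᵘ ℚᵘ.+ mkℚᵘ (+ p) d) ℚᵘ.* mkℚᵘ (+ b) 0           ∎
        where open ℚᵘₚ.≤-Reasoning
      l : + a ℤ.* (+ suc ((d + 0 * suc d) * 1)) ≡ + (a * suc d)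
      l = trans (sym (ℤₚ.pos-* a _)) (cong (λ e → + (a * suc e)) (trans (ℕₚ.*-identityʳ _) (ℕₚ.+-identityʳ d)))
      r : (+ 1 ℤ.* + suc d ℤ.+ + p ℤ.* + 1) ℤ.* + b ℤ.* + 1 ≡ + ((suc d + p) * b)
      r = begin
        (+ 1 ℤ.* + suc d ℤ.+ + p ℤ.* + 1) ℤ.* + b ℤ.* + 1  ≡⟨ ℤₚ.*-identityʳ _ ⟩
        (+ 1 ℤ.* + suc d ℤ.+ + p ℤ.* + 1) ℤ.* + b          ≡⟨ cong (ℤ._* + b) (cong₂ ℤ._+_ (ℤₚ.*-identityˡ (+ suc d)) (ℤₚ.*-identityʳ (+ p))) ⟩
        + (suc d + p) ℤ.* + b                              ≡⟨ ℤₚ.pos-* (suc d + p) b ⟨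
        + ((suc d + p) * b)                                ∎
        where open ≡-Reasoning

    ≤-*ε⇒ : ∀ a b → ⟦ a ⟧ ℚ.≤ ⟦ b ⟧ ℚ.* ε → a * suc d ≤ b * p
    ≤-*ε⇒ a b le = toℕ-≤ (subst₂ ℤ._≤_ l r (ℚᵘₚ.drop-*≤* le′))
      where
      le′ : mkℚᵘ (+ a) 0 ℚᵘ.≤ mkℚᵘ (+ b) 0 ℚᵘ.* mkℚᵘ (+ p) d
      le′ = begin
        mkℚᵘ (+ a) 0                         ≃⟨ toℚᵘ-/ a 0 ⟨
        toℚᵘ ⟦ a ⟧                           ≤⟨ ℚₚ.toℚᵘ-mono-≤ le ⟩
        toℚᵘ (⟦ b ⟧ ℚ.* ε)                   ≃⟨ ℚₚ.toℚᵘ-homo-* ⟦ b ⟧ ε ⟩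
        toℚᵘ ⟦ b ⟧ ℚᵘ.* toℚᵘ ε               ≃⟨ ℚᵘₚ.*-cong (toℚᵘ-/ b 0) (ℚᵘₚ.≃-reflexive ε≡p/d) ⟩
        mkℚᵘ (+ b) 0 ℚᵘ.* mkℚᵘ (+ p) d       ∎
        where open ℚᵘₚ.≤-Reasoning
      l : + a ℤ.* (+ suc (d + 0 * suc d)) ≡ + (a * suc d)
      l = trans (sym (ℤₚ.pos-* a _)) (cong (λ e → + (a * suc e)) (ℕₚ.+-identityʳ d))
      r : + b ℤ.* + p ℤ.* + 1 ≡ + (b * p)
      r = trans (ℤₚ.*-identityʳ _) (sym (ℤₚ.pos-* b p))

    ≤⇒≤-*ε : ∀ k s R D → k * suc d ≤ suc D * (s * R * p) → (+ 1 ℚ./ suc D) ℚ.* ⟦ k ⟧ ℚ.≤ ⟦ s ⟧ ℚ.* ⟦ R ⟧ ℚ.* ε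
    ≤⇒≤-*ε k s R D le = ℚₚ.toℚᵘ-cancel-≤ (begin
        toℚᵘ ((+ 1 ℚ./ suc D) ℚ.* ⟦ k ⟧)          ≃⟨ ℚₚ.toℚᵘ-homo-* (+ 1 ℚ./ suc D) ⟦ k ⟧ ⟩
        toℚᵘ (+ 1 ℚ./ suc D) ℚᵘ.* toℚᵘ ⟦ k ⟧      ≃⟨ ℚᵘₚ.*-cong (toℚᵘ-/ 1 D) (toℚᵘ-/ k 0) ⟩
        mkℚᵘ (+ 1) D ℚᵘ.* mkℚᵘ (+ k) 0            ≤⟨ ℚᵘ.*≤* (subst₂ ℤ._≤_ (sym l) (sym r) (ℤ.+≤+ le)) ⟩
        mkℚᵘ (+ s) 0 ℚᵘ.* mkℚᵘ (+ R) 0 ℚᵘ.* mkℚᵘ (+ p) d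
          ≃⟨ ℚᵘₚ.*-cong (ℚᵘₚ.*-cong (toℚᵘ-/ s 0) (toℚᵘ-/ R 0)) (ℚᵘₚ.≃-reflexive ε≡p/d) ⟨
        toℚᵘ ⟦ s ⟧ ℚᵘ.* toℚᵘ ⟦ R ⟧ ℚᵘ.* toℚᵘ ε    ≃⟨ ℚᵘₚ.*-congʳ {x = toℚᵘ ε} (ℚₚ.toℚᵘ-homo-* ⟦ s ⟧ ⟦ R ⟧) ⟨
        toℚᵘ (⟦ s ⟧ ℚ.* ⟦ R ⟧) ℚᵘ.* toℚᵘ ε        ≃⟨ ℚₚ.toℚᵘ-homo-* (⟦ s ⟧ ℚ.* ⟦ R ⟧) ε ⟨
        toℚᵘ (⟦ s ⟧ ℚ.* ⟦ R ⟧ ℚ.* ε)              ∎)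
      where
      open ℚᵘₚ.≤-Reasoning
      l : + 1 ℤ.* + k ℤ.* + suc (d + 0 * suc d) ≡ + (k * suc d)
      l = ≡.begin
        + 1 ℤ.* + k ℤ.* + suc (d + 0 * suc d)     ≡.≡⟨ cong₂ (λ e f → e ℤ.* + suc f) (ℤₚ.*-identityˡ (+ k)) (ℕₚ.+-identityʳ d) ⟩
        + k ℤ.* + suc d                           ≡.≡⟨ ℤₚ.pos-* k (suc d) ⟨
        + (k * suc d)                             ≡.∎
        where module ≡ = ≡-Reasoning
      r : + s ℤ.* + R ℤ.* + p ℤ.* + suc (D * 1) ≡ + (suc D * (s * R * p))
      r = ≡.begin
        + s ℤ.* + R ℤ.* + p ℤ.* + suc (D * 1)     ≡.≡⟨ cong₂ (λ e f → e ℤ.* + p ℤ.* + suc f) (sym (ℤₚ.pos-* s R)) (ℕₚ.*-identityʳ D) ⟩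
        + (s * R) ℤ.* + p ℤ.* + suc D             ≡.≡⟨ cong (ℤ._* + suc D) (ℤₚ.pos-* (s * R) p) ⟨
        + (s * R * p) ℤ.* + suc D                 ≡.≡⟨ ℤₚ.pos-* (s * R * p) (suc D) ⟨
        + (s * R * p * suc D)                     ≡.≡⟨ cong +_ (ℕₚ.*-comm (s * R * p) (suc D)) ⟩
        + (suc D * (s * R * p))                   ≡.∎
        where module ≡ = ≡-Reasoning

    module _ {k n R s : ℕ} (A : Alg k n R s) (approx : Approximates A ε) where

      -- LCS(x₁) ≤ output on x₁ = output on x₀ ≤ (1 + ε) LCS(x₀). The bounds `L₁` and `L₀` then
      -- replace the exact values at both ends.
      same-output⇒ratio : ∀ (x₀ x₁ y : Vec (Fin k) n) → output A y x₁ ≡ output A y x₀ → ∀ L₀ L₁ →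
        (∀ z → CommonSubseq z (Vec.toList x₀) (Vec.toList y) → length z ≤ L₀) →
        ∃[ z ] (CommonSubseq z (Vec.toList x₁) (Vec.toList y) × L₁ ≤ length z) →
        L₁ * suc d ≤ (suc d + p) * L₀
      same-output⇒ratio x₀ x₁ y same L₀ L₁ upper (z , common , L₁≤z) =
        let m₀ , lcs₀ = lcs-exists Finₚ._≟_ (Vec.toList x₀) (Vec.toList y)
            m₁ , lcs₁ = lcs-exists Finₚ._≟_ (Vec.toList x₁) (Vec.toList y)
            z₀ , common₀ , eq₀ = proj₁ lcs₀
            m₀≤L₀ = subst (_≤ L₀) eq₀ (upper z₀ common₀)
            L₁≤m₁ = ℕₚ.≤-trans L₁≤z (proj₂ lcs₁ z common)
            lower = proj₁ (approx x₁ y m₁ lcs₁)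
            above = subst (ℚ._≤ (1ℚ ℚ.+ ε) ℚ.* ⟦ m₀ ⟧) (sym same) (proj₂ (approx x₀ y m₀ lcs₀))
            ratio = ≤-scaled m₁ m₀ (ℚₚ.≤-trans lower above)
        in ℕₚ.≤-trans (ℕₚ.*-monoˡ-≤ (suc d) L₁≤m₁) (ℕₚ.≤-trans ratio (ℕₚ.*-monoʳ-≤ (suc d + p) m₀≤L₀))

-- Large ε: increasing sequences

vecOf : ∀ {X : Set} {n} (l : List X) → length l ≡ n → Vec X n
vecOf l refl = Vec.fromList l

toList-vecOf : ∀ {X : Set} {n} (l : List X) (eq : length l ≡ n) → Vec.toList (vecOf l eq) ≡ l
toList-vecOf l refl = Vecₚ.toList∘fromList l

toList-replicate : ∀ {X : Set} n (x : X) → Vec.toList (Vec.replicate n x) ≡ replicate n x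
toList-replicate zero x = refl
toList-replicate (suc n) x = cong (x ∷_) (toList-replicate n x)

∈-replicate⁻ : ∀ {X : Set} n {x u : X} → u ∈ replicate n x → u ≡ x
∈-replicate⁻ (suc n) (here u≡x) = u≡x
∈-replicate⁻ (suc n) (there u∈) = ∈-replicate⁻ n u∈

∈-power⁻ : ∀ {X : Set} t {v : List X} {u} → u ∈ power t v → u ∈ v
∈-power⁻ (suc t) {v} u∈ with ∈ₚ.∈-++⁻ v u∈
... | inj₁ u∈v = u∈v
... | inj₂ u∈p = ∈-power⁻ t u∈p

⊆-replicate-++⁻ : ∀ {X : Set} c {x : X} {u v} → u ⊆ replicate c x ++ v → u ⊆ v ⊎ ∃[ u′ ] u ≡ x ∷ u′
⊆-replicate-++⁻ zero p = inj₁ p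
⊆-replicate-++⁻ (suc c) (_ ∷ʳ p) = ⊆-replicate-++⁻ c p
⊆-replicate-++⁻ (suc c) (refl ∷ p) = inj₂ (_ , refl)

unique-resp-⊇ : ∀ {X : Set} {xs ys : List X} → xs ⊆ ys → Unique ys → Unique xs
unique-resp-⊇ [] [] = []
unique-resp-⊇ (_ ∷ʳ p) (_ ∷ ys!) = unique-resp-⊇ p ys!
unique-resp-⊇ (refl ∷ p) (y∉ys ∷ ys!) = ⊆ₚ.All-resp-⊆ p y∉ys ∷ unique-resp-⊇ p ys!

4*classes : ∀ s R B → 4 * ((2 ^ s * 2 ^ s) ^ R * B) ≡ 2 ^ (2 + (s + s) * R) * B
4*classes s R B = begin
  4 * ((2 ^ s * 2 ^ s) ^ R * B)     ≡⟨ cong (λ e → 4 * (e ^ R * B)) (ℕₚ.^-distribˡ-+-* 2 s s) ⟨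
  4 * ((2 ^ (s + s)) ^ R * B)       ≡⟨ cong (λ e → 4 * (e * B)) (ℕₚ.^-*-assoc 2 (s + s) R) ⟩
  4 * (2 ^ ((s + s) * R) * B)       ≡⟨ ℕₚ.*-assoc 4 (2 ^ ((s + s) * R)) B ⟨
  4 * 2 ^ ((s + s) * R) * B         ≡⟨ cong (_* B) (ℕₚ.^-distribˡ-+-* 2 2 ((s + s) * R)) ⟨
  2 ^ (2 + (s + s) * R) * B         ∎
  where open ≡-Reasoning

2*m<n⇒m≤n/2 : ∀ {m n} → 2 * m < n → m ≤ n / 2
2*m<n⇒m≤n/2 {m} {n} 2m<n = subst (_≤ n / 2) (trans (cong (_/ 2) (ℕₚ.*-comm 2 m)) (DivMod.m*n/n≡m m 2))
  (DivMod./-monoˡ-≤ 2 (ℕₚ.<⇒≤ 2m<n))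

2*[n/2]≤n : ∀ n → 2 * (n / 2) ≤ n
2*[n/2]≤n n = subst (_≤ n) (ℕₚ.*-comm (n / 2) 2) (DivMod.m/n*n≤m n 2)

-- Symbol 0 only pads y; the hidden words are w-tuples of the other symbols.
module RegimeI {K w c t R s : ℕ} (t≡9K : t ≡ 9 * K) (K≤n : K ≤ c + t * w) (a₀ : Fin K)
         (ε : ℚ) (p d : ℕ) (ε≡p/d : toℚᵘ ε ≡ mkℚᵘ (ℤ.+ p) d)
         (A : Alg (suc K) (c + t * w) R s) (approx : Approximates A ε)
         (low-memory : 2 + (s + s) * R ≤ w) where

  private
    n = c + t * w
    Hidden = Vec (Fin K) w

    ylist : List (Fin (suc K))
    ylist = replicate (n ∸ K) zero ++ List.map suc (allFin K)

    length-ylist : length ylist ≡ n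
    length-ylist = trans (Listₚ.length-++ (replicate (n ∸ K) zero))
      (trans (cong₂ _+_ (Listₚ.length-replicate (n ∸ K))
                        (trans (Listₚ.length-map suc (allFin K)) (Listₚ.length-tabulate {n = K} Function.id)))
             (ℕₚ.m∸n+n≡m K≤n))

    y : Vec (Fin (suc K)) n
    y = vecOf ylist length-ylist

    enc : Hidden → Vec (Fin (suc K)) w
    enc = Vec.map suc

    Q? : (h v : Hidden) (a : Fin K) → Dec (a ∈ Vec.toList v)
    Q? h v a = any? (a Finₚ.≟_) (Vec.toList v)

    -- The words of `C` are tuples over the symbols that occur in `C`, and there are at most K/2 of
    -- these.
    sparse⇒small : ∀ C → Unique C → ∀ h →
      2 * ∑ (allFin K) (λ a → 𝟙 (does (any? (λ v → Q? h v a) C))) < K → length C ≤ (K / 2) ^ w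
    sparse⇒small C C! h sparse = begin
      length C                               ≤⟨ unique-⊆⇒length≤ C! C⊆ ⟩
      length (choices {m = w} (const U))     ≡⟨ length-choices-const w U ⟩
      length U ^ w                           ≤⟨ ℕₚ.^-monoˡ-≤ w (2*m<n⇒m≤n/2 (subst (λ u → 2 * u < K) (sym (length-filter occurs? (allFin K))) sparse)) ⟩
      (K / 2) ^ w                            ∎
      where
      open ℕₚ.≤-Reasoning
      occurs? : ∀ a → Dec (Any (λ v → a ∈ Vec.toList v) C)
      occurs? a = any? (λ v → Q? h v a) C
      U = filter occurs? (allFin K)
      lookup∈ : ∀ {m} (v : Vec (Fin K) m) i → Vec.lookup v i ∈ Vec.toList v
      lookup∈ (x ∷ v) zero = here refl
      lookup∈ (x ∷ v) (suc i) = there (lookup∈ v i)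
      C⊆ : ∀ {v} → v ∈ C → v ∈ choices (const U)
      C⊆ {v} v∈C = choices-complete (const U) v
        (λ i → ∈ₚ.∈-filter⁺ occurs? (∈ₚ.∈-allFin _) (lose v∈C (lookup∈ v i)))

    -- Halving the alphabet costs one bit per symbol, `w` bits in all. They pay for the 2sR bits of
    -- a trace and the 2 bits of the factor 4.
    few : 4 * ((2 ^ s * 2 ^ s) ^ R * (K / 2) ^ w) ≤ length (choices {m = w} (const (allFin K)))
    few = begin
      4 * ((2 ^ s * 2 ^ s) ^ R * (K / 2) ^ w)        ≡⟨ 4*classes s R ((K / 2) ^ w) ⟩
      2 ^ (2 + (s + s) * R) * (K / 2) ^ w            ≤⟨ ℕₚ.*-monoˡ-≤ ((K / 2) ^ w) (ℕₚ.^-monoʳ-≤ 2 low-memory) ⟩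
      2 ^ w * (K / 2) ^ w                            ≡⟨ ^-distribʳ-* w 2 (K / 2) ⟨
      (2 * (K / 2)) ^ w                              ≤⟨ ℕₚ.^-monoˡ-≤ w (2*[n/2]≤n K) ⟩
      K ^ w                                          ≡⟨ cong (_^ w) (Listₚ.length-tabulate {n = K} Function.id) ⟨
      length (allFin K) ^ w                          ≡⟨ length-choices-const w (allFin K) ⟨
      length (choices {m = w} (const (allFin K)))    ∎
      where
      open ℕₚ.≤-Reasoning
      ^-distribʳ-* : ∀ e a b → (a * b) ^ e ≡ a ^ e * b ^ e
      ^-distribʳ-* zero a b = refl
      ^-distribʳ-* (suc e) a b = trans (cong (a * b *_) (^-distribʳ-* e a b)) (interchange a b (a ^ e) (b ^ e))
        where interchange : ∀ a b c d → a * b * (c * d) ≡ a * c * (b * d)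
              interchange = solve-∀

    choices≢[] : ∀ m → 1 ≤ length (choices {m = m} (const (allFin K)))
    choices≢[] m = nonempty (choices-complete (const (allFin K)) (Vec.replicate m a₀) (λ i → ∈ₚ.∈-allFin _))
      where nonempty : ∀ {X : Set} {x : X} {xs} → x ∈ xs → 1 ≤ length xs
            nonempty (here _) = s≤s z≤n
            nonempty (there _) = s≤s z≤n

    pad : Vec (Fin (suc K)) c
    pad = Vec.replicate c (suc a₀)

  module _ (conf : Confusion {c = c} {t = t} A y enc pad Q?) where

    open Confusion conf

    -- `x₀` contains no 0 and `y` has every other symbol once, so `z` is free of repetitions. Its
    -- symbols are among the `w` entries of `h` and the symbol of the pad, hence `suc w`.
    upper : ∀ z → CommonSubseq z (Vec.toList x₀) (Vec.toList y) → length z ≤ suc w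
    upper z (z⊆x , z⊆y) = begin
      length z                                    ≤⟨ unique-⊆⇒length≤ z! (∈symbols ∘ ⊆.lookup z⊆x) ⟩
      length (List.map suc (a₀ ∷ Vec.toList h))   ≡⟨ cong suc (trans (Listₚ.length-map suc (Vec.toList h)) (length-toList h)) ⟩
      suc w                                       ∎
      where
      open ℕₚ.≤-Reasoning
      ∈symbols : ∀ {u} → u ∈ Vec.toList x₀ → u ∈ List.map suc (a₀ ∷ Vec.toList h)
      ∈symbols {u} u∈x with ∈ₚ.∈-++⁻ (Vec.toList pad) (subst (u ∈_) x₀-form u∈x)
      ... | inj₁ u∈pad = here (∈-replicate⁻ c (subst (u ∈_) (toList-replicate c (suc a₀)) u∈pad))
      ... | inj₂ u∈pow = there (subst (u ∈_) (Vecₚ.toList-map suc h) (∈-power⁻ t u∈pow))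
      0∉z : zero ∉ z
      0∉z 0∈z with ∈ₚ.∈-map⁻ suc (∈symbols (⊆.lookup z⊆x 0∈z))
      ... | _ , _ , ()
      drop-padding : ∀ {vs} → z ⊆ vs ⊎ (∃[ z′ ] z ≡ zero ∷ z′) → z ⊆ vs
      drop-padding (inj₁ z⊆vs) = z⊆vs
      drop-padding (inj₂ (_ , eq)) = contradiction (subst (zero ∈_) (sym eq) (here refl)) 0∉z
      z! : Unique z
      z! = unique-resp-⊇ (drop-padding (⊆-replicate-++⁻ (n ∸ K) (subst (z ⊆_) (toList-vecOf ylist length-ylist) z⊆y)))
             (Uniqueₚ.map⁺ Finₚ.suc-injective (Uniqueₚ.allFin⁺ K))

    deviates? : ∀ a → Dec (a ∈ Vec.toList (v a))
    deviates? a = Q? h (v a) a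

    increasing : List (Fin (suc K))
    increasing = List.map suc (filter deviates? (allFin K))

    hits : ∀ a → a ∈ Vec.toList (v a) → suc a ∷ [] ⊆ triple enc h (v a)
    hits a a∈v = ⊆ₚ.++⁺ˡ (word enc h) (⊆ₚ.++⁺ʳ (word enc h)
      (from∈ (subst (suc a ∈_) (sym (Vecₚ.toList-map suc (v a))) (∈ₚ.∈-map⁺ suc a∈v))))

    increasing⊆triples : ∀ {m} (f : Fin m → Fin K) →
      List.map suc (filter deviates? (tabulate f)) ⊆ concat (tabulate (λ i → triple enc h (v (f i))))
    increasing⊆triples {zero} f = []
    increasing⊆triples {suc m} f with deviates? (f zero)
    ... | yes a∈v = ⊆ₚ.++⁺ (hits (f zero) a∈v) (increasing⊆triples (f ∘ suc))
    ... | no _ = ⊆ₚ.++⁺ˡ (triple enc h (v (f zero))) (increasing⊆triples (f ∘ suc))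

    lower : ∃[ z ] (CommonSubseq z (Vec.toList x₁) (Vec.toList y) ×
                    ∑ (allFin K) (λ a → 𝟙 (does (deviates? a))) ≤ length z)
    lower = increasing ,
      ( subst (increasing ⊆_) (sym x₁-form)
          (⊆ₚ.++⁺ˡ (Vec.toList pad) (⊆ₚ.++⁺ˡ (power σ (word enc h))
            (⊆ₚ.++⁺ʳ _ (increasing⊆triples Function.id))))
      , subst (increasing ⊆_) (sym (toList-vecOf ylist length-ylist))
          (⊆ₚ.++⁺ˡ (replicate (n ∸ K) zero) (⊆ₚ.map⁺ suc (⊆ₚ.filter-⊆ deviates? (allFin K))))) ,
      ℕₚ.≤-reflexive (trans (sym (length-filter deviates? (allFin K)))
                            (sym (Listₚ.length-map suc (filter deviates? (allFin K)))))

    confused : 3 * K * suc d ≤ 16 * ((suc d + p) * suc w)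
    confused = begin
      3 * K * suc d       ≤⟨ ℕₚ.*-monoˡ-≤ (suc d) many ⟩
      16 * L₁ * suc d     ≡⟨ ℕₚ.*-assoc 16 L₁ (suc d) ⟩
      16 * (L₁ * suc d)   ≤⟨ ℕₚ.*-monoʳ-≤ 16 (same-output⇒ratio ε p d ε≡p/d A approx x₀ x₁ y same-output (suc w) L₁ upper lower) ⟩
      16 * ((suc d + p) * suc w) ∎
      where
      open ℕₚ.≤-Reasoning
      L₁ = ∑ (allFin K) (λ a → 𝟙 (does (deviates? a)))

  regime-I : 3 * K * suc d ≤ 16 * ((suc d + p) * suc w)
  regime-I = confused (confusion {c = c} {t = t} t≡9K A y enc pad
    (choices (const (allFin K))) (choices-unique (λ _ → Uniqueₚ.allFin⁺ K)) (choices≢[] w)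
    (ℕₚ.≤-trans (s≤s z≤n) (Finₚ.toℕ<n a₀)) Q? ((K / 2) ^ w) sparse⇒small few)

-- Periodic binary words

module _ {X : Set} where

  ⊆-drop-prefix : ∀ {x : X} {zs} xs {ys} → x ∉ xs → x ∷ zs ⊆ xs ++ ys → x ∷ zs ⊆ ys
  ⊆-drop-prefix [] x∉xs p = p
  ⊆-drop-prefix (_ ∷ xs) x∉xs (_ ∷ʳ p) = ⊆-drop-prefix xs (x∉xs ∘ there) p
  ⊆-drop-prefix (_ ∷ xs) x∉xs (refl ∷ p) = contradiction (here refl) x∉xs

  ⊆-split : ∀ {zs} (xs : List X) {ys} → zs ⊆ xs ++ ys → ∃₂ λ us vs → zs ≡ us ++ vs × us ⊆ xs × vs ⊆ ys
  ⊆-split [] p = [] , _ , refl , [] , p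
  ⊆-split (x ∷ xs) (_ ∷ʳ p) = let us , vs , eq , p₁ , p₂ = ⊆-split xs p in us , vs , eq , _ ∷ʳ p₁ , p₂
  ⊆-split (x ∷ xs) (refl ∷ p) =
    let us , vs , eq , p₁ , p₂ = ⊆-split xs p in x ∷ us , vs , cong (x ∷_) eq , refl ∷ p₁ , p₂

  ++-⊆-split : ∀ (us : List X) {vs xs} → us ++ vs ⊆ xs → ∃₂ λ xs₁ xs₂ → xs ≡ xs₁ ++ xs₂ × us ⊆ xs₁ × vs ⊆ xs₂
  ++-⊆-split [] p = [] , _ , refl , [] , p
  ++-⊆-split (u ∷ us) (x ∷ʳ p) =
    let xs₁ , xs₂ , eq , p₁ , p₂ = ++-⊆-split (u ∷ us) p in x ∷ xs₁ , xs₂ , cong (x ∷_) eq , x ∷ʳ p₁ , p₂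
  ++-⊆-split (u ∷ us) (refl ∷ p) =
    let xs₁ , xs₂ , eq , p₁ , p₂ = ++-⊆-split us p in u ∷ xs₁ , xs₂ , cong (u ∷_) eq , refl ∷ p₁ , p₂

  -- Levi's lemma.
  ++-≡-cases : ∀ (us : List X) {vs} xs {ys} → us ++ vs ≡ xs ++ ys →
               (∃[ us′ ] (us ≡ xs ++ us′ × ys ≡ us′ ++ vs)) ⊎ (∃[ vs′ ] (xs ≡ us ++ vs′ × vs ≡ vs′ ++ ys))
  ++-≡-cases us [] eq = inj₁ (us , refl , sym eq)
  ++-≡-cases [] (x ∷ xs) eq = inj₂ (x ∷ xs , refl , eq)
  ++-≡-cases (u ∷ us) (x ∷ xs) eq with Listₚ.∷-injective eq
  ... | refl , eq′ with ++-≡-cases us xs eq′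
  ... | inj₁ (us′ , eq₁ , eq₂) = inj₁ (us′ , cong (u ∷_) eq₁ , eq₂)
  ... | inj₂ (vs′ , eq₁ , eq₂) = inj₂ (vs′ , cong (u ∷_) eq₁ , eq₂)

module _ {X Y : Set} where

  ⊆-map⁻ : ∀ (f : X → Y) {zs} xs → zs ⊆ List.map f xs → ∃[ us ] (zs ≡ List.map f us × us ⊆ xs)
  ⊆-map⁻ f [] [] = [] , refl , []
  ⊆-map⁻ f (x ∷ xs) (_ ∷ʳ p) = let us , eq , q = ⊆-map⁻ f xs p in us , eq , x ∷ʳ q
  ⊆-map⁻ f (x ∷ xs) (refl ∷ p) = let us , eq , q = ⊆-map⁻ f xs p in x ∷ us , cong (f x ∷_) eq , refl ∷ q

  mapMaybe-⊆ : ∀ (f : X → Maybe Y) {xs ys} → xs ⊆ ys → mapMaybe f xs ⊆ mapMaybe f ys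
  mapMaybe-⊆ f [] = []
  mapMaybe-⊆ f (y ∷ʳ p) with f y
  ... | just v = v ∷ʳ mapMaybe-⊆ f p
  ... | nothing = mapMaybe-⊆ f p
  mapMaybe-⊆ f {x ∷ _} (refl ∷ p) with f x
  ... | just v = refl ∷ mapMaybe-⊆ f p
  ... | nothing = mapMaybe-⊆ f p

  mapMaybe-power : ∀ (f : X → Maybe Y) t xs → mapMaybe f (power t xs) ≡ power t (mapMaybe f xs)
  mapMaybe-power f zero xs = refl
  mapMaybe-power f (suc t) xs =
    trans (Listₚ.mapMaybe-++ f xs (power t xs)) (cong (mapMaybe f xs ++_) (mapMaybe-power f t xs))

-- Both cells have two β's and one α and begin with β; the bit moves only the α. Letter counts, and
-- the absence of adjacent α's, are therefore independent of the bits.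
cell : Bool → List Bool
cell true  = true ∷ false ∷ true ∷ []
cell false = true ∷ true ∷ false ∷ []

gadget : ∀ {z} → Vec Bool z → List Bool
gadget [] = []
gadget (b ∷ p) = cell b ++ gadget p

plateau : ℕ → ℕ → ℕ → List Bool
plateau A B C = replicate A false ++ replicate B true ++ replicate C false

trues falses : List Bool → ℕ
trues [] = 0
trues (true ∷ l) = suc (trues l)
trues (false ∷ l) = trues l
falses [] = 0
falses (true ∷ l) = falses l
falses (false ∷ l) = suc (falses l)

falses-++ : ∀ l l′ → falses (l ++ l′) ≡ falses l + falses l′
falses-++ [] l′ = refl
falses-++ (true ∷ l) l′ = falses-++ l l′
falses-++ (false ∷ l) l′ = cong suc (falses-++ l l′)

trues-++ : ∀ l l′ → trues (l ++ l′) ≡ trues l + trues l′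
trues-++ [] l′ = refl
trues-++ (true ∷ l) l′ = cong suc (trues-++ l l′)
trues-++ (false ∷ l) l′ = trues-++ l l′

⊆-falses : ∀ n {u l} → u ⊆ replicate n false → u ⊆ l → length u ≤ falses l
⊆-falses n {[]} _ _ = z≤n
⊆-falses n {x ∷ u} {true ∷ l} p (_ ∷ʳ q) = ⊆-falses n p q
⊆-falses n {x ∷ u} {false ∷ l} p (_ ∷ʳ q) = ℕₚ.m≤n⇒m≤1+n (⊆-falses n p q)
⊆-falses (suc n) (_ ∷ʳ p) q@(refl ∷ _) = ⊆-falses n p q
⊆-falses (suc n) (refl ∷ p) (refl ∷ q) = s≤s (⊆-falses n p q)

⊆-trues : ∀ n {u l} → u ⊆ replicate n true → u ⊆ l → length u ≤ trues l
⊆-trues n {[]} _ _ = z≤n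
⊆-trues n {x ∷ u} {false ∷ l} p (_ ∷ʳ q) = ⊆-trues n p q
⊆-trues n {x ∷ u} {true ∷ l} p (_ ∷ʳ q) = ℕₚ.m≤n⇒m≤1+n (⊆-trues n p q)
⊆-trues (suc n) (_ ∷ʳ p) q@(refl ∷ _) = ⊆-trues n p q
⊆-trues (suc n) (refl ∷ p) (refl ∷ q) = s≤s (⊆-trues n p q)

-- Bits are indexed by all of ℕ, so that a window of β's can be extended past the end of the word
-- when periodicity is used.
cells : (ℕ → Bool) → ℕ → List Bool
cells b zero = []
cells b (suc n) = cell (b 0) ++ cells (b ∘ suc) n

-- The number of falses in front of the i-th true (counting from 0) of cells b.
before : (ℕ → Bool) → ℕ → ℕ
before b 0 = 0
before b 1 = 𝟙 (b 0)
before b (suc (suc i)) = suc (before (b ∘ suc) i)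

before-lipschitz : ∀ b i → before b (suc i) ≤ suc (before b i)
before-lipschitz b 0 with b 0
... | true = s≤s z≤n
... | false = z≤n
before-lipschitz b 1 = s≤s z≤n
before-lipschitz b (suc (suc i)) = s≤s (before-lipschitz (b ∘ suc) i)

before-+ : ∀ b i j → before b (j + i) ≤ j + before b i
before-+ b i zero = ℕₚ.≤-refl
before-+ b i (suc j) = ℕₚ.≤-trans (before-lipschitz b (j + i)) (s≤s (before-+ b i j))

before-cong : ∀ {b b′} → (∀ u → b u ≡ b′ u) → ∀ i → before b i ≡ before b′ i
before-cong b≗b′ 0 = refl
before-cong b≗b′ 1 = cong 𝟙 (b≗b′ 0)
before-cong b≗b′ (suc (suc i)) = cong suc (before-cong (b≗b′ ∘ suc) i)

before-shift : ∀ b z i → before b (z * 2 + i) ≡ z + before (b ∘ (z +_)) i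
before-shift b zero i = refl
before-shift b (suc z) i = cong suc (before-shift (b ∘ suc) z i)

-- The prefix `X` stops before the β numbered `trues X`, so all its α's precede that β. Conversely,
-- in `falses-lower`, the α's in front of a β inside `X` lie in `X`.
falses-upper : ∀ b n X {Y} → X ++ Y ≡ cells b n → falses X ≤ before b (trues X)
falses-upper b n [] eq = z≤n
falses-upper b (suc n) (x ∷ []) eq with b 0
... | true with refl , _ ← Listₚ.∷-injective eq = z≤n
... | false with refl , _ ← Listₚ.∷-injective eq = z≤n
falses-upper b (suc n) (x ∷ x′ ∷ []) eq with b 0 in b0
... | true with refl , eq′ ← Listₚ.∷-injective eq with refl , _ ← Listₚ.∷-injective eq′ rewrite b0 = s≤s z≤n
... | false with refl , eq′ ← Listₚ.∷-injective eq with refl , _ ← Listₚ.∷-injective eq′ = z≤n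
falses-upper b (suc n) (x ∷ x′ ∷ x″ ∷ X) eq with b 0
... | true with refl , eq′ ← Listₚ.∷-injective eq with refl , eq″ ← Listₚ.∷-injective eq′
           with refl , eq‴ ← Listₚ.∷-injective eq″ = s≤s (falses-upper (b ∘ suc) n X eq‴)
... | false with refl , eq′ ← Listₚ.∷-injective eq with refl , eq″ ← Listₚ.∷-injective eq′
            with refl , eq‴ ← Listₚ.∷-injective eq″ = s≤s (falses-upper (b ∘ suc) n X eq‴)

falses-lower : ∀ b n X {Y} → X ++ Y ≡ cells b n → ∀ i → i < trues X → before b i ≤ falses X
falses-lower b n X eq zero _ = z≤n
falses-lower b (suc n) (x ∷ []) eq (suc i) i< with b 0
falses-lower b (suc n) (x ∷ []) eq (suc i) i< | true with refl , _ ← Listₚ.∷-injective eq with s≤s () ← i<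
falses-lower b (suc n) (x ∷ []) eq (suc i) i< | false with refl , _ ← Listₚ.∷-injective eq with s≤s () ← i<
falses-lower b (suc n) (x ∷ x′ ∷ []) eq (suc i) i< with b 0 in b0
falses-lower b (suc n) (x ∷ x′ ∷ []) eq (suc i) i< | true
  with refl , eq′ ← Listₚ.∷-injective eq with refl , _ ← Listₚ.∷-injective eq′ with s≤s () ← i<
falses-lower b (suc n) (x ∷ x′ ∷ []) eq (suc zero) i< | false rewrite b0 = z≤n
falses-lower b (suc n) (x ∷ x′ ∷ []) eq (suc (suc i)) i< | false
  with refl , eq′ ← Listₚ.∷-injective eq with refl , _ ← Listₚ.∷-injective eq′ with s≤s (s≤s ()) ← i<
falses-lower b (suc n) (x ∷ x′ ∷ x″ ∷ X) eq (suc i) i< with b 0 in b0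
... | true with refl , eq′ ← Listₚ.∷-injective eq with refl , eq″ ← Listₚ.∷-injective eq′
           with refl , eq‴ ← Listₚ.∷-injective eq″ = third i i<
  where
  third : ∀ i → suc i < suc (suc (trues X)) → before b (suc i) ≤ suc (falses X)
  third zero _ rewrite b0 = s≤s z≤n
  third (suc i) (s≤s (s≤s i<)) = s≤s (falses-lower (b ∘ suc) n X eq‴ i i<)
... | false with refl , eq′ ← Listₚ.∷-injective eq with refl , eq″ ← Listₚ.∷-injective eq′
            with refl , eq‴ ← Listₚ.∷-injective eq″ = third i i<
  where
  third : ∀ i → suc i < suc (suc (trues X)) → before b (suc i) ≤ suc (falses X)
  third zero _ rewrite b0 = z≤n
  third (suc i) (s≤s (s≤s i<)) = s≤s (falses-lower (b ∘ suc) n X eq‴ i i<)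

falses-cells : ∀ b n → falses (cells b n) ≡ n
falses-cells b zero = refl
falses-cells b (suc n) with b 0
... | true = cong suc (falses-cells (b ∘ suc) n)
... | false = cong suc (falses-cells (b ∘ suc) n)

cells-cong : ∀ {b b′} → (∀ u → b u ≡ b′ u) → ∀ n → cells b n ≡ cells b′ n
cells-cong b≗b′ zero = refl
cells-cong b≗b′ (suc n) = cong₂ _++_ (cong cell (b≗b′ 0)) (cells-cong (b≗b′ ∘ suc) n)

cells-+ : ∀ b m n → cells b (m + n) ≡ cells b m ++ cells (b ∘ (m +_)) n
cells-+ b zero n = refl
cells-+ b (suc m) n = trans (cong (cell (b 0) ++_) (cells-+ (b ∘ suc) m n)) (sym (Listₚ.++-assoc (cell (b 0)) _ _))

module _ {z : ℕ} (b : ℕ → Bool) (periodic : ∀ u → b (z + u) ≡ b u) where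

  cells-periodic : ∀ r → cells b (r * z) ≡ power r (cells b z)
  cells-periodic zero = refl
  cells-periodic (suc r) = trans (cells-+ b z (r * z))
    (cong (cells b z ++_) (trans (cells-cong periodic (r * z)) (cells-periodic r)))

  -- Any 2z + 1 consecutive trues of a z-periodic sequence of cells enclose
  -- exactly z falses, and there is at most one false between two trues.
  plateau-bound : ∀ r A C {u} → u ⊆ plateau A (z * 2 + 1) C → u ⊆ cells b (r * z) → length u ≤ suc z + r * z
  plateau-bound r A C u⊆plateau u⊆cells with ⊆-split (replicate A false) u⊆plateau
  ... | u₁ , u₂₃ , refl , u₁⊆ , u₂₃⊆ with ⊆-split (replicate (z * 2 + 1) true) u₂₃⊆
  ... | u₂ , u₃ , refl , u₂⊆ , u₃⊆ with ++-⊆-split u₁ u⊆cells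
  ... | X₁ , X₂₃ , eq , u₁⊆X₁ , u₂₃⊆X₂₃ with ++-⊆-split u₂ u₂₃⊆X₂₃
  ... | X₂ , X₃ , refl , u₂⊆X₂ , u₃⊆X₃ = begin
    length (u₁ ++ u₂ ++ u₃)                     ≡⟨ trans (Listₚ.length-++ u₁) (cong (length u₁ +_) (Listₚ.length-++ u₂)) ⟩
    length u₁ + (length u₂ + length u₃)         ≤⟨ ℕₚ.+-mono-≤ (⊆-falses A u₁⊆ u₁⊆X₁)
                                                     (ℕₚ.+-mono-≤ (middle (length u₂) (⊆-trues _ u₂⊆ u₂⊆X₂) short) (⊆-falses C u₃⊆ u₃⊆X₃)) ⟩
    falses X₁ + (suc z + falses X₂ + falses X₃) ≡⟨ regroup (falses X₁) (falses X₂) (falses X₃) z ⟩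
    suc z + (falses X₁ + (falses X₂ + falses X₃)) ≡⟨ cong (suc z +_) total ⟨
    suc z + r * z                               ∎
    where
    open ℕₚ.≤-Reasoning
    regroup : ∀ a b c z → a + (suc z + b + c) ≡ suc z + (a + (b + c))
    regroup = solve-∀
    total : r * z ≡ falses X₁ + (falses X₂ + falses X₃)
    total = trans (sym (falses-cells b (r * z))) (trans (cong falses eq)
      (trans (falses-++ X₁ (X₂ ++ X₃)) (cong (falses X₁ +_) (falses-++ X₂ X₃))))
    short : length u₂ ≤ z * 2 + 1
    short = subst (length u₂ ≤_) (Listₚ.length-replicate (z * 2 + 1)) (⊆ₚ.length-mono-≤ u₂⊆)
    eq₁₂ : (X₁ ++ X₂) ++ X₃ ≡ cells b (r * z)
    eq₁₂ = trans (Listₚ.++-assoc X₁ X₂ X₃) (sym eq)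
    middle : ∀ B → B ≤ trues X₂ → B ≤ z * 2 + 1 → B ≤ suc z + falses X₂
    middle zero _ _ = z≤n
    -- With `i = trues X₁`, the prefix `X₁ ++ X₂` contains the β numbered `B + i`. Between the β's
    -- numbered i and i + 2z there are exactly z α's, and each of the last 2z - B steps passes at
    -- most one of them. Hence `X₂` holds at least B - z α's.
    middle (suc B) B<trues B≤2z+1 = s≤s (ℕₚ.+-cancelˡ-≤ (falses X₁ + z) _ _ (begin
      falses X₁ + z + B                               ≤⟨ ℕₚ.+-monoˡ-≤ B (ℕₚ.+-monoˡ-≤ z (falses-upper b (r * z) X₁ (sym eq))) ⟩
      before b i + z + B                              ≡⟨ cong (_+ B) (ℕₚ.+-comm (before b i) z) ⟩
      z + before b i + B                              ≡⟨ cong (λ e → z + e + B) (before-cong periodic i) ⟨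
      z + before (b ∘ (z +_)) i + B                   ≡⟨ cong (_+ B) (before-shift b z i) ⟨
      before b (z * 2 + i) + B                        ≡⟨ cong (λ e → before b e + B) split ⟩
      before b ((z * 2 ∸ B) + (B + i)) + B            ≤⟨ ℕₚ.+-monoˡ-≤ B (before-+ b (B + i) (z * 2 ∸ B)) ⟩
      z * 2 ∸ B + before b (B + i) + B                ≤⟨ ℕₚ.+-monoˡ-≤ B (ℕₚ.+-monoʳ-≤ (z * 2 ∸ B) (falses-lower b (r * z) (X₁ ++ X₂) eq₁₂ (B + i) inside)) ⟩
      z * 2 ∸ B + falses (X₁ ++ X₂) + B               ≡⟨ trans (regroup′ (z * 2 ∸ B) (falses (X₁ ++ X₂)) B) (cong₂ _+_ (ℕₚ.m∸n+n≡m B≤2z) (falses-++ X₁ X₂)) ⟩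
      z * 2 + (falses X₁ + falses X₂)                 ≡⟨ regroup″ z (falses X₁) (falses X₂) ⟩
      falses X₁ + z + (z + falses X₂)                 ∎))
      where
      i = trues X₁
      B≤2z : B ≤ z * 2
      B≤2z = ℕₚ.≤-pred (subst (suc B ≤_) (ℕₚ.+-comm (z * 2) 1) B≤2z+1)
      split : z * 2 + i ≡ (z * 2 ∸ B) + (B + i)
      split = trans (cong (_+ i) (sym (ℕₚ.m∸n+n≡m B≤2z))) (ℕₚ.+-assoc (z * 2 ∸ B) B i)
      inside : B + i < trues (X₁ ++ X₂)
      inside = ℕₚ.≤-trans (ℕₚ.≤-reflexive (ℕₚ.+-comm (suc B) i))
        (ℕₚ.≤-trans (ℕₚ.+-monoʳ-≤ i B<trues) (ℕₚ.≤-reflexive (sym (trues-++ X₁ X₂))))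
      regroup′ : ∀ a b c → a + b + c ≡ (a + c) + b
      regroup′ = solve-∀
      regroup″ : ∀ z a b → z * 2 + (a + b) ≡ a + z + (z + b)
      regroup″ = solve-∀

module _ {z : ℕ} (p : Vec Bool (suc z)) where

  cyclic : ℕ → Bool
  cyclic u = Vec.lookup p (u mod suc z)

  mod-cong : ∀ {u v} → u % suc z ≡ v % suc z → u mod suc z ≡ v mod suc z
  mod-cong {u} {v} eq = Finₚ.toℕ-injective (trans (Finₚ.toℕ-fromℕ< _) (trans eq (sym (Finₚ.toℕ-fromℕ< _))))

  cyclic-periodic : ∀ u → cyclic (suc z + u) ≡ cyclic u
  cyclic-periodic u = cong (Vec.lookup p) (mod-cong {suc z + u} {u}
    (trans (cong (_% suc z) (ℕₚ.+-comm (suc z) u)) (DivMod.[m+n]%n≡m%n u (suc z))))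

  cyclic-toℕ : ∀ i → cyclic (toℕ i) ≡ Vec.lookup p i
  cyclic-toℕ i = cong (Vec.lookup p) (Finₚ.toℕ-injective
    (trans (Finₚ.toℕ-fromℕ< _) (DivMod.m<n⇒m%n≡m (Finₚ.toℕ<n i))))

cells≡gadget : ∀ {z} (p : Vec Bool z) b → (∀ i → b (toℕ i) ≡ Vec.lookup p i) → cells b z ≡ gadget p
cells≡gadget [] b eq = refl
cells≡gadget (x ∷ p) b eq = cong₂ _++_ (cong cell (eq zero)) (cells≡gadget p (b ∘ suc) (eq ∘ suc))

gadget-bound : ∀ {z} (p : Vec Bool (suc z)) r A C {u} →
               u ⊆ plateau A (suc z * 2 + 1) C → u ⊆ power r (gadget p) → length u ≤ suc (suc z) + r * suc z
gadget-bound {z} p r A C {u} u⊆plateau u⊆gadgets =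
  plateau-bound (cyclic p) (cyclic-periodic p) r A C u⊆plateau (subst (u ⊆_) powers u⊆gadgets)
  where
  powers : power r (gadget p) ≡ cells (cyclic p) (r * suc z)
  powers = trans (cong (power r) (sym (cells≡gadget p (cyclic p) (cyclic-toℕ p))))
                 (sym (cells-periodic (cyclic p) (cyclic-periodic p) r))

-- Upper bound for constant inputs

-- A symbol is a chunk index together with true (β) or false (α).
Sym : ℕ → Set
Sym K = Fin K × Bool

first : ∀ {K} → Bool → Sym (suc K)
first b = zero , b

shift : ∀ {K} → Sym K → Sym (suc K)
shift (a , b) = suc a , b

chunks : ∀ {K} → (Fin K → List Bool) → List (Sym K)
chunks {zero} f = []
chunks {suc K} f = List.map first (f zero) ++ List.map shift (chunks (f ∘ suc))

-- Chunks come in decreasing order, so that a subsequence of chunks f takes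
-- symbols of a single chunk from each block.
block : ∀ {K z} → Vec (Vec Bool z) K → List (Sym K)
block [] = []
block (p ∷ h) = List.map shift (block h) ++ List.map first (gadget p)

first∉shift : ∀ {K b} (S : List (Sym K)) → first b ∉ List.map shift S
first∉shift S b∈ with ∈ₚ.∈-map⁻ shift b∈
... | _ , _ , ()

shift∉first : ∀ {K} {a : Sym K} g → shift a ∉ List.map first g
shift∉first g a∈ with ∈ₚ.∈-map⁻ first a∈
... | _ , _ , ()

module _ {K} (S : List (Sym K)) (g : List Bool) where

  private
    W = List.map shift S ++ List.map first g

  -- In a copy of W nothing of the first chunk precedes any later chunk.
  separate : ∀ r u v → List.map first u ++ List.map shift v ⊆ power r W →
             ∃₂ λ r₁ r₂ → r₁ + r₂ ≡ r × List.map first u ⊆ power r₁ W × List.map shift v ⊆ power r₂ W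
  separate zero u v p = 0 , 0 , refl , ⊆-trans (⊆ₚ.++⁺ʳ _ ⊆-refl) p , ⊆-trans (⊆ₚ.++⁺ˡ (List.map first u) ⊆-refl) p
  separate (suc r) u v p with ⊆-split W p
  ... | w₁ , w₂ , eq , w₁⊆W , w₂⊆ with ++-≡-cases (List.map first u) w₁ eq
  ... | inj₁ (u₂ , eq₁ , refl) with ⊆-map⁻ first u (⊆-trans (⊆ₚ.++⁺ˡ w₁ ⊆-refl) (⊆-reflexive (sym eq₁)))
  ... | u′ , refl , _ with separate r u′ v w₂⊆
  ... | r₁ , r₂ , sum , u₂⊆ , v⊆ = suc r₁ , r₂ , cong suc sum , subst (_⊆ power (suc r₁) W) (sym eq₁) (⊆ₚ.++⁺ w₁⊆W u₂⊆) , v⊆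
  separate (suc r) [] v p | w₁ , w₂ , eq , w₁⊆W , w₂⊆ | inj₂ (v₁ , refl , eq₂) =
    0 , suc r , refl , [] , subst (_⊆ power (suc r) W) (sym eq₂) (⊆ₚ.++⁺ w₁⊆W w₂⊆)
  separate (suc r) (b ∷ u) v p | w₁ , w₂ , eq , w₁⊆W , w₂⊆ | inj₂ ([] , refl , eq₂) =
    1 , r , refl , ⊆ₚ.++⁺ʳ [] (subst (_⊆ W) (Listₚ.++-identityʳ _) w₁⊆W) , subst (_⊆ power r W) (sym eq₂) w₂⊆
  separate (suc r) (b ∷ u) v p | w₁ , w₂ , eq , w₁⊆W , w₂⊆ | inj₂ (y ∷ v₁ , refl , eq₂)
    with ⊆-drop-prefix (List.map shift S) (first∉shift S) w₁⊆W
  ... | q with ∈ₚ.∈-map⁻ shift (subst (y ∈_) (sym eq₂) (here refl))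
  ... | a , _ , refl = contradiction
    (⊆.lookup q (∈ₚ.∈-++⁺ʳ (first b ∷ List.map first u) (here refl))) (shift∉first g)

-- Erasing the other chunks preserves ⊆ and turns a block into the gadget of the first chunk;
-- erasing the first chunk leaves a block with one chunk fewer.
π-first : ∀ {K} → Sym (suc K) → Maybe Bool
π-first (zero , b) = just b
π-first (suc _ , _) = nothing

π-shift : ∀ {K} → Sym (suc K) → Maybe (Sym K)
π-shift (zero , _) = nothing
π-shift (suc a , b) = just (a , b)

module _ {K : ℕ} (S : List (Sym K)) (g : List Bool) where

  π-first-first : mapMaybe π-first (List.map (first {K}) g) ≡ g
  π-first-first = trans (Listₚ.mapMaybe-map π-first first g) (Listₚ.mapMaybe-just g)

  π-shift-shift : mapMaybe π-shift (List.map shift S) ≡ S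
  π-shift-shift = trans (Listₚ.mapMaybe-map π-shift shift S) (Listₚ.mapMaybe-just S)

  π-first-block : mapMaybe π-first (List.map shift S ++ List.map first g) ≡ g
  π-first-block = trans (Listₚ.mapMaybe-++ π-first (List.map shift S) (List.map first g))
    (cong₂ _++_ (trans (Listₚ.mapMaybe-map π-first shift S) (Listₚ.mapMaybe-nothing S)) π-first-first)

  π-shift-block : mapMaybe π-shift (List.map shift S ++ List.map first g) ≡ S
  π-shift-block = trans (Listₚ.mapMaybe-++ π-shift (List.map shift S) (List.map first g))
    (trans (cong₂ _++_ π-shift-shift (trans (Listₚ.mapMaybe-map π-shift first g) (Listₚ.mapMaybe-nothing g)))
           (Listₚ.++-identityʳ S))

-- Chunks ascend in `y` and descend in each block, so `separate` assigns every block to a single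
-- chunk. A chunk with r₁ blocks yields at most z + 2 + r₁(z + 1), whatever its arms `A` and `C`;
-- this is what allows `y` to be padded with α's.
chunks-bound : ∀ {K z} (h : Vec (Vec Bool (suc z)) K) (A C : Fin K → ℕ) r {w} →
               w ⊆ chunks (λ a → plateau (A a) (suc z * 2 + 1) (C a)) → w ⊆ power r (block h) →
               length w ≤ suc (suc z) * K + r * suc z
chunks-bound [] A C r [] _ = z≤n
chunks-bound {suc K} {z} (p ∷ h) A C r w⊆y w⊆x with ⊆-split (List.map first (plateau (A zero) (suc z * 2 + 1) (C zero))) w⊆y
... | u , v , refl , u⊆y , v⊆y
  with ⊆-map⁻ first (plateau (A zero) (suc z * 2 + 1) (C zero)) u⊆y
     | ⊆-map⁻ shift (chunks (λ a → plateau (A (suc a)) (suc z * 2 + 1) (C (suc a)))) v⊆y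
... | u′ , refl , u′⊆y | v′ , refl , v′⊆y with separate (block h) (gadget p) r u′ v′ w⊆x
... | r₁ , r₂ , sum , u⊆x , v⊆x = begin
  length (List.map (first {K}) u′ ++ List.map shift v′)   ≡⟨ trans (Listₚ.length-++ (List.map first u′))
                                                               (cong₂ _+_ (Listₚ.length-map first u′) (Listₚ.length-map shift v′)) ⟩
  length u′ + length v′                                   ≤⟨ ℕₚ.+-mono-≤ (gadget-bound p r₁ (A zero) (C zero) u′⊆y u′⊆x)
                                                               (chunks-bound h (A ∘ suc) (C ∘ suc) r₂ v′⊆y v′⊆x) ⟩
  suc (suc z) + r₁ * suc z + (suc (suc z) * K + r₂ * suc z)  ≡⟨ regroup z K r₁ r₂ ⟩
  suc (suc z) * suc K + (r₁ + r₂) * suc z                 ≡⟨ cong (λ r → suc (suc z) * suc K + r * suc z) sum ⟩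
  suc (suc z) * suc K + r * suc z                         ∎
  where
  open ℕₚ.≤-Reasoning
  W = block (p ∷ h)
  regroup : ∀ z K r₁ r₂ → suc (suc z) + r₁ * suc z + (suc (suc z) * K + r₂ * suc z) ≡
                          suc (suc z) * suc K + (r₁ + r₂) * suc z
  regroup = solve-∀
  u′⊆x : u′ ⊆ power r₁ (gadget p)
  u′⊆x = subst₂ _⊆_ (π-first-first (block h) u′)
    (trans (mapMaybe-power π-first r₁ W) (cong (power r₁) (π-first-block (block h) (gadget p))))
    (mapMaybe-⊆ π-first u⊆x)
  v′⊆x : v′ ⊆ power r₂ (block h)
  v′⊆x = subst₂ _⊆_ (π-shift-shift v′ (gadget p))
    (trans (mapMaybe-power π-shift r₂ W) (cong (power r₂) (π-shift-block (block h) (gadget p))))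
    (mapMaybe-⊆ π-shift v⊆x)

true∉replicate-false : ∀ n → true ∉ replicate n false
true∉replicate-false (suc n) (there true∈) = true∉replicate-false n true∈

-- Meant for common subsequences that begin in the padding of `x`: from the first β of the last
-- chunk on, `y` consists of that chunk's β's and one arm of α's.
from-last-β : ∀ K (A C : Fin (suc K) → ℕ) B {w} →
              (fromℕ K , true) ∷ w ⊆ chunks (λ a → plateau (A a) B (C a)) →
              suc (length w) ≤ B + C (fromℕ K)
from-last-β zero A C B p =
  subst (_ ≤_) (trans (cong length (Listₚ.++-identityʳ (List.map first tail))) len)
    (⊆ₚ.length-mono-≤ (⊆-drop-prefix (List.map first (replicate (A zero) false)) ∉front
      (subst (_ ⊆_) (trans (cong (_++ []) (Listₚ.map-++ first (replicate (A zero) false) tail))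
                           (Listₚ.++-assoc (List.map first (replicate (A zero) false)) (List.map first tail) [])) p)))
  where
  tail = replicate B true ++ replicate (C zero) false
  ∉front : first true ∉ List.map first (replicate (A zero) false)
  ∉front t∈ with ∈ₚ.∈-map⁻ first t∈
  ... | _ , t∈′ , refl = true∉replicate-false (A zero) t∈′
  len : length (List.map (first {0}) tail) ≡ B + C zero
  len = trans (Listₚ.length-map first tail) (trans (Listₚ.length-++ (replicate B true))
    (cong₂ _+_ (Listₚ.length-replicate B) (Listₚ.length-replicate (C zero))))
from-last-β (suc K) A C B p
  with ⊆-map⁻ shift (chunks (λ a → plateau (A (suc a)) B (C (suc a))))
         (⊆-drop-prefix (List.map first (plateau (A zero) B (C zero))) (shift∉first (plateau (A zero) B (C zero))) p)
... | _ ∷ w′ , refl , q = subst (λ l → suc l ≤ _) (sym (Listₚ.length-map shift w′)) (from-last-β K (A ∘ suc) (C ∘ suc) B q)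

-- Lower bound for deviating inputs

module _ {X : Set} where

  replicate-+ : ∀ m n (x : X) → replicate (m + n) x ≡ replicate m x ++ replicate n x
  replicate-+ zero n x = refl
  replicate-+ (suc m) n x = cong (x ∷_) (replicate-+ m n x)

  replicate-⊆ : ∀ {m n} (x : X) → m ≤ n → replicate m x ⊆ replicate n x
  replicate-⊆ x z≤n = minimum _
  replicate-⊆ x (s≤s m≤n) = refl ∷ replicate-⊆ x m≤n

  replicate-⊆-power : ∀ t {m} {x : X} {w} → replicate m x ⊆ w → replicate (t * m) x ⊆ power t w
  replicate-⊆-power zero p = []
  replicate-⊆-power (suc t) {m} {x} p =
    subst (_⊆ _) (sym (replicate-+ m (t * m) x)) (⊆ₚ.++⁺ p (replicate-⊆-power t p))

falses⊆gadget : ∀ {z} (p : Vec Bool z) → replicate z false ⊆ gadget p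
falses⊆gadget [] = []
falses⊆gadget (true ∷ p) = _ ∷ʳ refl ∷ _ ∷ʳ falses⊆gadget p
falses⊆gadget (false ∷ p) = _ ∷ʳ _ ∷ʳ refl ∷ falses⊆gadget p

trues⊆gadget : ∀ {z} (p : Vec Bool z) → replicate (z * 2) true ⊆ gadget p
trues⊆gadget [] = []
trues⊆gadget (true ∷ p) = refl ∷ _ ∷ʳ refl ∷ trues⊆gadget p
trues⊆gadget (false ∷ p) = refl ∷ refl ∷ _ ∷ʳ trues⊆gadget p

true∷falses⊆gadget : ∀ {z} (p : Vec Bool (suc z)) → true ∷ replicate (suc z) false ⊆ gadget p
true∷falses⊆gadget (true ∷ p) = refl ∷ refl ∷ _ ∷ʳ falses⊆gadget p
true∷falses⊆gadget (false ∷ p) = refl ∷ _ ∷ʳ refl ∷ falses⊆gadget p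

plateau-split : ∀ A i j C → plateau A (i + j) C ≡
                (replicate A false ++ replicate i true) ++ (replicate j true ++ replicate C false)
plateau-split A i j C = begin
  replicate A false ++ replicate (i + j) true ++ replicate C false
    ≡⟨ cong (λ l → replicate A false ++ l ++ replicate C false) (replicate-+ i j true) ⟩
  replicate A false ++ (replicate i true ++ replicate j true) ++ replicate C false
    ≡⟨ cong (replicate A false ++_) (Listₚ.++-assoc (replicate i true) _ _) ⟩
  replicate A false ++ replicate i true ++ (replicate j true ++ replicate C false)
    ≡⟨ Listₚ.++-assoc (replicate A false) _ _ ⟨
  (replicate A false ++ replicate i true) ++ (replicate j true ++ replicate C false) ∎
  where open ≡-Reasoning

-- The left arm comes from the first gadget and all β's but one from the second. The remaining β is
-- the first letter of the third gadget and costs none of its α's.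
plateau⊆gadgets : ∀ {z} (p q r : Vec Bool (suc z)) →
                  plateau (suc z) (suc z * 2 + 1) (suc z) ⊆ gadget p ++ gadget q ++ gadget r
plateau⊆gadgets {z} p q r = subst (_⊆ gadget p ++ gadget q ++ gadget r)
  (sym (trans (plateau-split (suc z) (suc z * 2) 1 (suc z)) (Listₚ.++-assoc (replicate (suc z) false) _ _)))
  (⊆ₚ.++⁺ (falses⊆gadget p) (⊆ₚ.++⁺ (trues⊆gadget q) (true∷falses⊆gadget r)))

-- Where p has the cell βαβ and p′ has ββα, one α more can be used around a
-- full run of β's.
record Gain {z} (p p′ : Vec Bool z) : Set where
  field
    A C i j : ℕ
    A+C : A + C ≡ suc z
    i+j : i + j ≡ z * 2 + 1
    A≤z : A ≤ z
    C≤z : C ≤ z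
    ⊆left : replicate A false ++ replicate i true ⊆ gadget p
    ⊆right : replicate j true ++ replicate C false ⊆ gadget p′

-- A common leading cell gives its α to the left part and its two β's to the right part.
gain-∷ : ∀ {z} b {p p′ : Vec Bool z} → Gain p p′ → Gain (b ∷ p) (b ∷ p′)
gain-∷ b G = record
  { A = suc A ; C = C ; i = i ; j = 2 + j ; A+C = cong suc A+C
  ; i+j = trans (trans (ℕₚ.+-suc i (suc j)) (cong suc (ℕₚ.+-suc i j))) (cong (2 +_) i+j)
  ; A≤z = s≤s A≤z ; C≤z = ℕₚ.m≤n⇒m≤1+n C≤z
  ; ⊆left = ⊆ₚ.++⁺ (false⊆ b) ⊆left ; ⊆right = ⊆ₚ.++⁺ (trues⊆ b) ⊆right }
  where
  open Gain G
  false⊆ : ∀ b → false ∷ [] ⊆ cell b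
  false⊆ true = _ ∷ʳ refl ∷ _ ∷ʳ []
  false⊆ false = _ ∷ʳ _ ∷ʳ refl ∷ []
  trues⊆ : ∀ b → true ∷ true ∷ [] ⊆ cell b
  trues⊆ true = refl ∷ _ ∷ʳ refl ∷ []
  trues⊆ false = refl ∷ refl ∷ _ ∷ʳ []

-- At the difference, βαβ supplies αβ to the left part and ββα is used whole by the right part: only
-- the leading β is skipped. After that, the cells of `p` give their β's and those of `p′` their
-- α's.
gain-here : ∀ {z} (p p′ : Vec Bool z) → Gain (true ∷ p) (false ∷ p′)
gain-here {z} p p′ = record
  { A = 1 ; C = suc z ; i = 1 + z * 2 ; j = 2 ; A+C = refl ; i+j = e z
  ; A≤z = s≤s z≤n ; C≤z = ℕₚ.≤-refl
  ; ⊆left = _ ∷ʳ refl ∷ refl ∷ trues⊆gadget p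
  ; ⊆right = refl ∷ refl ∷ refl ∷ falses⊆gadget p′ }
  where
  e : ∀ z → 1 + z * 2 + 2 ≡ suc z * 2 + 1
  e = solve-∀

-- The first differing bit decides which of the two words has to come first.
gain : ∀ {z} (p q : Vec Bool z) → p ≢ q → Gain p q ⊎ Gain q p
gain [] [] p≢q = contradiction refl p≢q
gain (true ∷ p) (false ∷ q) _ = inj₁ (gain-here p q)
gain (false ∷ p) (true ∷ q) _ = inj₂ (gain-here q p)
gain (true ∷ p) (true ∷ q) p≢q with gain p q (p≢q ∘ cong (true ∷_))
... | inj₁ G = inj₁ (gain-∷ true G)
... | inj₂ G = inj₂ (gain-∷ true G)
gain (false ∷ p) (false ∷ q) p≢q with gain p q (p≢q ∘ cong (false ∷_))
... | inj₁ G = inj₁ (gain-∷ false G)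
... | inj₂ G = inj₂ (gain-∷ false G)

_≟ᵥ_ : ∀ {z} (p q : Vec Bool z) → Dec (p ≡ q)
_≟ᵥ_ = Vecₚ.≡-dec Boolₚ._≟_

record Ridge {z} (p q : Vec Bool z) (e : ℕ) : Set where
  field
    A C : ℕ
    A+C : A + C ≡ z * 2 + e
    A≤2z : A ≤ z * 2
    C≤2z : C ≤ z * 2
    ⊆gadgets : plateau A (z * 2 + 1) C ⊆ gadget p ++ gadget q ++ gadget p

-- With `p` on both sides of `q`, either order, p q or q p, is available for a gain, and the
-- remaining gadget lengthens one arm by all its α's. The total is one more than when `q` equals
-- `p`.
ridge : ∀ {z} (p q : Vec Bool (suc z)) (q≟p : Dec (q ≡ p)) → Ridge p q (𝟙 (does (¬? q≟p)))
ridge {z} p q (yes _) = record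
  { A = suc z ; C = suc z ; A≤2z = ℕₚ.m≤m*n (suc z) 2 ; C≤2z = ℕₚ.m≤m*n (suc z) 2
  ; A+C = e (suc z) ; ⊆gadgets = plateau⊆gadgets p q p }
  where e : ∀ n → n + n ≡ n * 2 + 0
        e = solve-∀
ridge {z} p q (no q≢p) with gain p q (q≢p ∘ sym)
... | inj₁ G = record
  { A = A ; C = C + n ; A≤2z = ℕₚ.≤-trans A≤z (ℕₚ.m≤m*n n 2)
  ; C≤2z = ℕₚ.≤-trans (ℕₚ.+-monoˡ-≤ n C≤z) (ℕₚ.≤-reflexive (e n))
  ; A+C = trans (sym (ℕₚ.+-assoc A C n)) (trans (cong (_+ n) A+C) (e′ n))
  ; ⊆gadgets = subst (_⊆ gadget p ++ gadget q ++ gadget p) (sym split) (⊆ₚ.++⁺ ⊆left (⊆ₚ.++⁺ ⊆right (falses⊆gadget p))) }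
  where
  open Gain G
  n = suc z
  e : ∀ n → n + n ≡ n * 2
  e = solve-∀
  e′ : ∀ n → suc n + n ≡ n * 2 + 1
  e′ = solve-∀
  split : plateau A (n * 2 + 1) (C + n) ≡
          (replicate A false ++ replicate i true) ++ (replicate j true ++ replicate C false) ++ replicate n false
  split = begin
    plateau A (n * 2 + 1) (C + n)  ≡⟨ cong (λ b → plateau A b (C + n)) i+j ⟨
    plateau A (i + j) (C + n)      ≡⟨ plateau-split A i j (C + n) ⟩
    left ++ (replicate j true ++ replicate (C + n) false)
                                   ≡⟨ cong (λ l → left ++ (replicate j true ++ l)) (replicate-+ C n false) ⟩
    left ++ (replicate j true ++ replicate C false ++ replicate n false)
                                   ≡⟨ cong (left ++_) (Listₚ.++-assoc (replicate j true) _ _) ⟨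
    left ++ (replicate j true ++ replicate C false) ++ replicate n false ∎
    where
    open ≡-Reasoning
    left = replicate A false ++ replicate i true
... | inj₂ G = record
  { A = n + A ; C = C ; C≤2z = ℕₚ.≤-trans C≤z (ℕₚ.m≤m*n n 2)
  ; A≤2z = ℕₚ.≤-trans (ℕₚ.+-monoʳ-≤ n A≤z) (ℕₚ.≤-reflexive (e n))
  ; A+C = trans (ℕₚ.+-assoc n A C) (trans (cong (n +_) A+C) (e′ n))
  ; ⊆gadgets = subst (_⊆ gadget p ++ gadget q ++ gadget p) (sym split) (⊆ₚ.++⁺ (falses⊆gadget p) (⊆ₚ.++⁺ ⊆left ⊆right)) }
  where
  open Gain G
  n = suc z
  e : ∀ n → n + n ≡ n * 2
  e = solve-∀
  e′ : ∀ n → n + suc n ≡ n * 2 + 1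
  e′ = solve-∀
  split : plateau (n + A) (n * 2 + 1) C ≡
          replicate n false ++ (replicate A false ++ replicate i true) ++ (replicate j true ++ replicate C false)
  split = begin
    plateau (n + A) (n * 2 + 1) C  ≡⟨ cong (λ b → plateau (n + A) b C) i+j ⟨
    plateau (n + A) (i + j) C      ≡⟨ plateau-split (n + A) i j C ⟩
    (replicate (n + A) false ++ replicate i true) ++ right
                                   ≡⟨ cong (λ l → (l ++ replicate i true) ++ right) (replicate-+ n A false) ⟩
    ((replicate n false ++ replicate A false) ++ replicate i true) ++ right
                                   ≡⟨ cong (_++ right) (Listₚ.++-assoc (replicate n false) _ _) ⟩
    (replicate n false ++ (replicate A false ++ replicate i true)) ++ right
                                   ≡⟨ Listₚ.++-assoc (replicate n false) _ _ ⟩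
    replicate n false ++ (replicate A false ++ replicate i true) ++ right ∎
    where
    open ≡-Reasoning
    right = replicate j true ++ replicate C false

plateau-⊆ : ∀ {pre A A′ C post C′} B → pre + A ≤ A′ → C + post ≤ C′ →
            replicate pre false ++ plateau A B C ++ replicate post false ⊆ plateau A′ B C′
plateau-⊆ {pre} {A} {A′} {C} {post} {C′} B ≤A′ ≤C′ = subst (_⊆ plateau A′ B C′) (sym eq)
  (⊆ₚ.++⁺ (replicate-⊆ false ≤A′) (⊆ₚ.++⁺ ⊆-refl (replicate-⊆ false ≤C′)))
  where
  open ≡-Reasoning
  F = λ n → replicate n false
  eq : F pre ++ plateau A B C ++ F post ≡ plateau (pre + A) B (C + post)
  eq = begin
    F pre ++ (F A ++ replicate B true ++ F C) ++ F post
      ≡⟨ cong (F pre ++_) (Listₚ.++-assoc (F A) _ _) ⟩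
    F pre ++ F A ++ (replicate B true ++ F C) ++ F post
      ≡⟨ cong (λ l → F pre ++ F A ++ l) (Listₚ.++-assoc (replicate B true) _ _) ⟩
    F pre ++ F A ++ replicate B true ++ F C ++ F post
      ≡⟨ Listₚ.++-assoc (F pre) _ _ ⟨
    (F pre ++ F A) ++ replicate B true ++ F C ++ F post
      ≡⟨ cong₂ (λ l l′ → l ++ replicate B true ++ l′) (replicate-+ pre A false) (replicate-+ C post false) ⟨
    plateau (pre + A) B (C + post) ∎

-- The surplus length of `y` goes into the leading α's of the first chunk, where the bound for
-- constant inputs does not notice it.
front : ∀ {K} → ℕ → ℕ → Fin (suc K) → ℕ
front s N zero = s + N
front s N (suc _) = N

target : ∀ K → ℕ → ℕ → ℕ → List (Sym (suc K))
target K s N B = chunks (λ a → plateau (front s N a) B N)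

chunks-mono : ∀ {K} {f g : Fin K → List Bool} → (∀ a → f a ⊆ g a) → chunks f ⊆ chunks g
chunks-mono {zero} f⊆g = []
chunks-mono {suc K} f⊆g = ⊆ₚ.++⁺ (⊆ₚ.map⁺ first (f⊆g zero)) (⊆ₚ.map⁺ shift (chunks-mono (f⊆g ∘ suc)))

-- α's of the first chunk placed in front merge with its left arm, and α's of the last chunk placed
-- behind merge with its right arm. The inner arms need only `M ≤ N`.
chunks⊆target : ∀ K {s N B pre post M} (A C : Fin (suc K) → ℕ) → (∀ a → A a ≤ M) → (∀ a → C a ≤ M) →
                pre + M ≤ s + N → M + post ≤ N →
                replicate pre (first false) ++ chunks (λ a → plateau (A a) B (C a)) ++ replicate post (fromℕ K , false)
                ⊆ target K s N B
chunks⊆target zero {s} {N} {B} {pre} {post} A C A≤M C≤M ≤front ≤N =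
  subst₂ _⊆_ eq (sym (Listₚ.++-identityʳ _)) (⊆ₚ.map⁺ first (plateau-⊆ {pre} {A zero} {s + N} {C zero} {post} B
    (ℕₚ.≤-trans (ℕₚ.+-monoʳ-≤ pre (A≤M zero)) ≤front) (ℕₚ.≤-trans (ℕₚ.+-monoˡ-≤ post (C≤M zero)) ≤N)))
  where
  open ≡-Reasoning
  P = plateau (A zero) B (C zero)
  eq : List.map first (replicate pre false ++ P ++ replicate post false) ≡
       replicate pre (first false) ++ (List.map first P ++ []) ++ replicate post (first false)
  eq = begin
    List.map first (replicate pre false ++ P ++ replicate post false)
      ≡⟨ trans (Listₚ.map-++ first (replicate pre false) _) (cong (_ ++_) (Listₚ.map-++ first P _)) ⟩
    List.map first (replicate pre false) ++ List.map first P ++ List.map first (replicate post false)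
      ≡⟨ cong₂ (λ l l′ → l ++ List.map first P ++ l′) (Listₚ.map-replicate first pre false) (Listₚ.map-replicate first post false) ⟩
    replicate pre (first false) ++ List.map first P ++ replicate post (first false)
      ≡⟨ cong (λ l → replicate pre (first false) ++ l ++ replicate post (first false)) (Listₚ.++-identityʳ _) ⟨
    replicate pre (first false) ++ (List.map first P ++ []) ++ replicate post (first false) ∎
chunks⊆target (suc K) {s} {N} {B} {pre} {post} {M} A C A≤M C≤M ≤front ≤N =
  subst (_⊆ target (suc K) s N B) (sym eq)
    (⊆ₚ.++⁺ (⊆ₚ.map⁺ first (subst (λ l → replicate pre false ++ l ⊆ plateau (s + N) B N) (Listₚ.++-identityʳ P)
              (plateau-⊆ {pre} {A zero} {s + N} {C zero} {0} B
                (ℕₚ.≤-trans (ℕₚ.+-monoʳ-≤ pre (A≤M zero)) ≤front)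
                (ℕₚ.≤-trans (ℕₚ.≤-reflexive (ℕₚ.+-identityʳ _)) (ℕₚ.≤-trans (C≤M zero) M≤N)))))
            (⊆ₚ.map⁺ shift (⊆-trans (chunks⊆target K {0} (A ∘ suc) (C ∘ suc) (A≤M ∘ suc) (C≤M ∘ suc) M≤N ≤N)
              (chunks-mono {f = λ a → plateau (front 0 N a) B N} {g = λ _ → plateau N B N}
                (λ { zero → ⊆-refl ; (suc _) → ⊆-refl })))))
  where
  open ≡-Reasoning
  M≤N : M ≤ N
  M≤N = ℕₚ.≤-trans (ℕₚ.m≤m+n M post) ≤N
  P = plateau (A zero) B (C zero)
  rest = chunks (λ a → plateau (A (suc a)) B (C (suc a)))
  eq : replicate pre (first false) ++ (List.map first P ++ List.map shift rest) ++ replicate post (fromℕ (suc K) , false) ≡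
       List.map first (replicate pre false ++ P) ++ List.map shift (rest ++ replicate post (fromℕ K , false))
  eq = begin
    replicate pre (first false) ++ (List.map first P ++ List.map shift rest) ++ replicate post (shift (fromℕ K , false))
      ≡⟨ cong₂ (λ l l′ → l ++ (List.map first P ++ List.map shift rest) ++ l′)
               (Listₚ.map-replicate first pre false) (Listₚ.map-replicate shift post (fromℕ K , false)) ⟨
    List.map first (replicate pre false) ++ (List.map first P ++ List.map shift rest) ++ List.map shift last
      ≡⟨ cong (List.map first (replicate pre false) ++_) (Listₚ.++-assoc (List.map first P) _ _) ⟩
    List.map first (replicate pre false) ++ List.map first P ++ (List.map shift rest ++ List.map shift last)
      ≡⟨ Listₚ.++-assoc (List.map first (replicate pre false)) _ _ ⟨
    (List.map first (replicate pre false) ++ List.map first P) ++ (List.map shift rest ++ List.map shift last)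
      ≡⟨ cong₂ _++_ (Listₚ.map-++ first (replicate pre false) P) (Listₚ.map-++ shift rest last) ⟨
    List.map first (replicate pre false ++ P) ++ List.map shift (rest ++ last) ∎
    where last = replicate post (fromℕ K , false)

chunks⊆concat : ∀ {X : Set} {K} (g : Sym K → X) (f : Fin K → List Bool) (T : Fin K → List X) →
                (∀ a → List.map (λ b → g (a , b)) (f a) ⊆ T a) → List.map g (chunks f) ⊆ concat (tabulate T)
chunks⊆concat {K = zero} g f T f⊆T = []
chunks⊆concat {K = suc K} g f T f⊆T = subst (_⊆ _) (sym (Listₚ.map-++ g (List.map first (f zero)) _))
  (⊆ₚ.++⁺ (subst (_⊆ T zero) (Listₚ.map-∘ (f zero)) (f⊆T zero))
          (subst (_⊆ _) (Listₚ.map-∘ (chunks (f ∘ suc))) (chunks⊆concat (g ∘ shift) (f ∘ suc) (T ∘ suc) (f⊆T ∘ suc))))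

gadget⊆block : ∀ {K z} (h : Vec (Vec Bool z) K) a → List.map (a ,_) (gadget (Vec.lookup h a)) ⊆ block h
gadget⊆block (p ∷ h) zero = ⊆ₚ.++⁺ˡ (List.map shift (block h)) ⊆-refl
gadget⊆block (p ∷ h) (suc a) = ⊆ₚ.++⁺ʳ (List.map first (gadget p))
  (subst (_⊆ _) (sym (Listₚ.map-∘ (gadget (Vec.lookup h a)))) (⊆ₚ.map⁺ shift (gadget⊆block h a)))

length-gadget : ∀ {z} (p : Vec Bool z) → length (gadget p) ≡ z * 3
length-gadget [] = refl
length-gadget (true ∷ p) = cong (3 +_) (length-gadget p)
length-gadget (false ∷ p) = cong (3 +_) (length-gadget p)

length-block : ∀ {K z} (h : Vec (Vec Bool z) K) → length (block h) ≡ K * (z * 3)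
length-block [] = refl
length-block {suc K} {z} (p ∷ h) = trans (Listₚ.length-++ (List.map shift (block h)))
  (trans (cong₂ _+_ (trans (Listₚ.length-map shift (block h)) (length-block h))
                    (trans (Listₚ.length-map first (gadget p)) (length-gadget p)))
         (ℕₚ.+-comm (K * (z * 3)) (z * 3)))

length-plateau : ∀ A B C → length (plateau A B C) ≡ A + (B + C)
length-plateau A B C = trans (Listₚ.length-++ (replicate A false)) (cong₂ _+_ (Listₚ.length-replicate A)
  (trans (Listₚ.length-++ (replicate B true)) (cong₂ _+_ (Listₚ.length-replicate B) (Listₚ.length-replicate C))))

∑-tabulate : ∀ {X : Set} {m} (f : Fin m → X) g → ∑ (tabulate f) g ≡ ∑ (List.allFin m) (g ∘ f)
∑-tabulate {m = zero} f g = refl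
∑-tabulate {m = suc m} f g = cong (g (f zero) +_) (trans (∑-tabulate (f ∘ suc) g) (sym (∑-tabulate suc (g ∘ f))))

length-chunks : ∀ {K} (f : Fin K → List Bool) → length (chunks f) ≡ ∑ (List.allFin K) (λ a → length (f a))
length-chunks {zero} f = refl
length-chunks {suc K} f = trans (Listₚ.length-++ (List.map first (f zero)))
  (cong₂ _+_ (Listₚ.length-map first (f zero))
    (trans (Listₚ.length-map shift (chunks (f ∘ suc))) (trans (length-chunks (f ∘ suc)) (sym (∑-tabulate (suc {K}) (length ∘ f))))))

length-target : ∀ K s N B → length (target K s N B) ≡ s + suc K * (N + (B + N))
length-target K s N B = begin
  length (target K s N B)                            ≡⟨ length-chunks (λ a → plateau (front {K} s N a) B N) ⟩
  length (plateau (s + N) B N) + ∑ (tabulate (suc {K})) (λ a → length (plateau (front s N a) B N))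
    ≡⟨ cong₂ _+_ (length-plateau (s + N) B N) (trans (∑-tabulate (suc {K}) (λ a → length (plateau (front s N a) B N)))
         (trans (∑-const (List.allFin K) (length (plateau N B N)))
                (cong₂ _*_ (Listₚ.length-tabulate {n = K} Function.id) (length-plateau N B N)))) ⟩
  s + N + (B + N) + K * (N + (B + N))                ≡⟨ e s N (B + N) K ⟩
  s + suc K * (N + (B + N))                          ∎
  where
  open ≡-Reasoning
  e : ∀ s N c K → s + N + c + K * (N + c) ≡ s + suc K * (N + c)
  e = solve-∀

-- Small ε: binary gadgets

map-power : ∀ {X Y : Set} (f : X → Y) t w → List.map f (power t w) ≡ power t (List.map f w)
map-power f zero w = refl
map-power f (suc t) w = trans (Listₚ.map-++ f w (power t w)) (cong (List.map f w ++_) (map-power f t w))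

⊆-map-injective : ∀ {X Y : Set} {f : X → Y} → (∀ {a b} → f a ≡ f b → a ≡ b) →
                  ∀ {xs ys} → List.map f xs ⊆ List.map f ys → xs ⊆ ys
⊆-map-injective inj {[]} p = minimum _
⊆-map-injective inj {x ∷ xs} {y ∷ ys} (_ ∷ʳ p) = y ∷ʳ ⊆-map-injective inj p
⊆-map-injective inj {x ∷ xs} {y ∷ ys} (eq ∷ p) = inj eq ∷ ⊆-map-injective inj p

-- A coordinate is either free, with 2^z choices, or fixed, with 2^0. Summing over `tabulate e`
-- instead of `allFin m` keeps the statement stable under induction.
length-choices-2^ : ∀ {X Y : Set} {m} z (U : Fin m → List X) (e : Fin m → Y) (g : Y → Bool) →
  (∀ i → length (U i) ≡ 2 ^ (z * 𝟙 (g (e i)))) → length (choices U) ≡ 2 ^ (z * ∑ (tabulate e) (𝟙 ∘ g))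
length-choices-2^ {m = zero} z U e g eq = cong (2 ^_) (sym (ℕₚ.*-zeroʳ z))
length-choices-2^ {m = suc m} z U e g eq = begin
  length (choices U)                                                 ≡⟨ length-cartesianProductWith _∷_ (U zero) _ ⟩
  length (U zero) * length (choices (U ∘ suc))                       ≡⟨ cong₂ _*_ (eq zero) (length-choices-2^ z (U ∘ suc) (e ∘ suc) g (eq ∘ suc)) ⟩
  2 ^ (z * 𝟙 (g (e zero))) * 2 ^ (z * ∑ (tabulate (e ∘ suc)) (𝟙 ∘ g)) ≡⟨ ℕₚ.^-distribˡ-+-* 2 (z * 𝟙 (g (e zero))) _ ⟨
  2 ^ (z * 𝟙 (g (e zero)) + z * ∑ (tabulate (e ∘ suc)) (𝟙 ∘ g))     ≡⟨ cong (2 ^_) (ℕₚ.*-distribˡ-+ z _ _) ⟨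
  2 ^ (z * ∑ (tabulate e) (𝟙 ∘ g))                                   ∎
  where open ≡-Reasoning

bits : ∀ z → List (Vec Bool z)
bits z = choices (const (true ∷ false ∷ []))

bits-complete : ∀ {z} (p : Vec Bool z) → p ∈ bits z
bits-complete p = choices-complete _ p (λ i → bool∈ (Vec.lookup p i))
  where
  bool∈ : ∀ b → b ∈ true ∷ false ∷ []
  bool∈ true = here refl
  bool∈ false = there (here refl)

bits-unique : ∀ z → Unique (bits z)
bits-unique z = choices-unique (λ _ → ((λ ()) ∷ []) ∷ [] ∷ [])

length-bits : ∀ z → length (bits z) ≡ 2 ^ z
length-bits z = length-choices-const z (true ∷ false ∷ [])

last-β-loss : ∀ κ Z → 1 ≤ κ → Z * 2 + 1 + (6 * κ * Z + Z * 2) ≤ κ + 10 * (κ * Z)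
last-β-loss κ Z 1≤κ = begin
  Z * 2 + 1 + (6 * κ * Z + Z * 2)      ≡⟨ e₁ κ Z ⟩
  1 + 4 * Z + 6 * (κ * Z)              ≤⟨ ℕₚ.+-monoˡ-≤ (6 * (κ * Z)) (ℕₚ.+-mono-≤ 1≤κ (ℕₚ.*-monoʳ-≤ 4 (ℕₚ.m≤n*m Z κ {{ℕ.>-nonZero 1≤κ}}))) ⟩
  κ + 4 * (κ * Z) + 6 * (κ * Z)        ≡⟨ e₂ κ (κ * Z) ⟩
  κ + 10 * (κ * Z)                     ∎
  where
  open ℕₚ.≤-Reasoning
  e₁ : ∀ κ Z → Z * 2 + 1 + (6 * κ * Z + Z * 2) ≡ 1 + 4 * Z + 6 * (κ * Z)
  e₁ = solve-∀
  e₂ : ∀ a b → a + 4 * b + 6 * b ≡ a + 10 * b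
  e₂ = solve-∀

-- With κ = suc K and Z = suc z, an arm of `y` has `N` α's: room for 6κZ from the constant blocks
-- outside the triples and for 2Z from a ridge.
module RegimeII {k K z c t ℓ N R s : ℕ}
         (t≡9κ : t ≡ 9 * suc K) (ℓ≡ : ℓ ≡ suc K * (suc z * 3)) (N≡ : N ≡ 6 * suc K * suc z + suc z * 2)
         (ι : Sym (suc K) → Fin k) (ι-injective : ∀ {a b} → ι a ≡ ι b → a ≡ b)
         (fits : suc K * (N + ((suc z * 2 + 1) + N)) ≤ c + t * ℓ)
         (ε : ℚ) (p d : ℕ) (ε≡p/d : toℚᵘ ε ≡ mkℚᵘ (ℤ.+ p) d)
         (A : Alg k (c + t * ℓ) R s) (approx : Approximates A ε)
         (low-memory : 4 + 2 * ((s + s) * R) ≤ suc z * suc K) where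

  private
    κ = suc K
    Z = suc z
    n = c + t * ℓ
    B = Z * 2 + 1
    Hidden = Vec (Vec Bool Z) κ

    slack : ℕ
    slack = n ∸ κ * (N + (B + N))

    ylist : List (Fin k)
    ylist = List.map ι (target K slack N B)

    length-ylist : length ylist ≡ n
    length-ylist = trans (Listₚ.length-map ι (target K slack N B))
      (trans (length-target K slack N B) (ℕₚ.m∸n+n≡m fits))

    y : Vec (Fin k) n
    y = vecOf ylist length-ylist

    length-word : ∀ h → length (List.map ι (block {κ} {Z} h)) ≡ ℓ
    length-word h = trans (Listₚ.length-map ι (block h)) (trans (length-block h) (sym ℓ≡))

    enc : Hidden → Vec (Fin k) ℓ
    enc h = vecOf (List.map ι (block h)) (length-word h)

    word≡ : ∀ h → word enc h ≡ List.map ι (block h)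
    word≡ h = toList-vecOf (List.map ι (block h)) (length-word h)

    Q? : (h v : Hidden) (a : Fin κ) → Dec (Vec.lookup v a ≢ Vec.lookup h a)
    Q? h v a = ¬? (Vec.lookup v a ≟ᵥ Vec.lookup h a)

    -- A pair at which no word of `C` differs from `h` is fixed; each of the others, at most κ/2 in
    -- number, contributes `Z` bits.
    sparse⇒small : ∀ C → Unique C → ∀ h →
      2 * ∑ (allFin κ) (λ a → 𝟙 (does (any? (λ v → Q? h v a) C))) < κ → length C ≤ 2 ^ (Z * (κ / 2))
    sparse⇒small C C! h sparse = begin
      length C                      ≤⟨ unique-⊆⇒length≤ C! C⊆ ⟩
      length (choices U)            ≡⟨ length-choices-2^ Z U Function.id (does ∘ varies?) length-U ⟩
      2 ^ (Z * varying)             ≤⟨ ℕₚ.^-monoʳ-≤ 2 (ℕₚ.*-monoʳ-≤ Z {varying} (2*m<n⇒m≤n/2 {varying} sparse)) ⟩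
      2 ^ (Z * (κ / 2))             ∎
      where
      open ℕₚ.≤-Reasoning
      varies? : ∀ a → Dec (Any (λ v → Vec.lookup v a ≢ Vec.lookup h a) C)
      varies? a = any? (λ v → Q? h v a) C
      varying = ∑ (allFin κ) (λ a → 𝟙 (does (varies? a)))
      options : ∀ a → Dec (Any (λ v → Vec.lookup v a ≢ Vec.lookup h a) C) → List (Vec Bool Z)
      options a (yes _) = bits Z
      options a (no _) = Vec.lookup h a ∷ []
      U : Fin κ → List (Vec Bool Z)
      U a = options a (varies? a)
      length-U : ∀ a → length (U a) ≡ 2 ^ (Z * 𝟙 (does (varies? a)))
      length-U a with varies? a
      ... | yes _ = trans (length-bits Z) (cong (2 ^_) (sym (ℕₚ.*-identityʳ Z)))
      ... | no _ = cong (2 ^_) (sym (ℕₚ.*-zeroʳ Z))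
      C⊆ : ∀ {v} → v ∈ C → v ∈ choices U
      C⊆ {v} v∈C = choices-complete U v ∈U
        where
        ∈U : ∀ a → Vec.lookup v a ∈ U a
        ∈U a with varies? a
        ... | yes _ = bits-complete (Vec.lookup v a)
        ... | no constant = here (decidable-stable (Vec.lookup v a ≟ᵥ Vec.lookup h a) (λ differs → constant (lose v∈C differs)))

    hs : List Hidden
    hs = choices (const (bits Z))

    length-hs : length hs ≡ 2 ^ (Z * κ)
    length-hs = trans (length-choices-const κ (bits Z)) (trans (cong (_^ κ) (length-bits Z)) (ℕₚ.^-*-assoc 2 Z κ))

    few : 4 * ((2 ^ s * 2 ^ s) ^ R * 2 ^ (Z * (κ / 2))) ≤ length hs
    few = begin
      4 * ((2 ^ s * 2 ^ s) ^ R * 2 ^ (Z * (κ / 2)))       ≡⟨ 4*classes s R (2 ^ (Z * (κ / 2))) ⟩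
      2 ^ (2 + (s + s) * R) * 2 ^ (Z * (κ / 2))           ≡⟨ ℕₚ.^-distribˡ-+-* 2 (2 + (s + s) * R) (Z * (κ / 2)) ⟨
      2 ^ (2 + (s + s) * R + Z * (κ / 2))                 ≤⟨ ℕₚ.^-monoʳ-≤ 2 (ℕₚ.*-cancelˡ-≤ {2 + (s + s) * R + Z * (κ / 2)} {Z * κ} 2 doubled) ⟩
      2 ^ (Z * κ)                                         ≡⟨ length-hs ⟨
      length hs                                           ∎
      where
      open ℕₚ.≤-Reasoning
      doubled : 2 * (2 + (s + s) * R + Z * (κ / 2)) ≤ 2 * (Z * κ)
      doubled = begin
        2 * (2 + (s + s) * R + Z * (κ / 2))               ≡⟨ e ((s + s) * R) Z (κ / 2) ⟩
        4 + 2 * ((s + s) * R) + Z * (2 * (κ / 2))         ≤⟨ ℕₚ.+-mono-≤ low-memory (ℕₚ.*-monoʳ-≤ Z (2*[n/2]≤n κ)) ⟩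
        Z * κ + Z * κ                                     ≡⟨ cong (λ e → Z * κ + e) (ℕₚ.+-identityʳ (Z * κ)) ⟨
        2 * (Z * κ)                                       ∎
        where e : ∀ m Z h → 2 * (2 + m + Z * h) ≡ 4 + 2 * m + Z * (2 * h)
              e = solve-∀

    hs≢[] : 1 ≤ length hs
    hs≢[] = subst (1 ≤_) (sym length-hs) (ℕₚ.m^n>0 2 (Z * κ))

    last-β : Sym κ
    last-β = fromℕ K , true

    -- Padding with α's could lengthen common subsequences. The last β can be matched only by giving
    -- up everything in `y` before the β's of the last chunk.
    pad : Vec (Fin k) c
    pad = Vec.replicate c (ι last-β)

    L₀ : ℕ
    L₀ = suc Z * κ + t * Z

    L₀≡ : L₀ ≡ κ + 10 * (κ * Z)
    L₀≡ = trans (cong (λ t → suc Z * κ + t * Z) t≡9κ) (e κ Z)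
      where e : ∀ κ Z → suc Z * κ + 9 * κ * Z ≡ κ + 10 * (κ * Z)
            e = solve-∀

    κ≤κZ : κ ≤ κ * Z
    κ≤κZ = ℕₚ.m≤m*n κ Z

    -- Either the padding of `x` is left out and `chunks-bound` applies, or the subsequence starts
    -- at a β of the last chunk, and what remains of `y` is no longer than `L₀`.
    L₀-bound : ∀ h {u} → u ⊆ target K slack N B → u ⊆ power t (block h) ⊎ (∃[ u′ ] u ≡ last-β ∷ u′) → length u ≤ L₀
    L₀-bound h u⊆target (inj₁ u⊆blocks) = chunks-bound h (front slack N) (const N) t u⊆target u⊆blocks
    L₀-bound h u⊆target (inj₂ (u′ , refl)) = begin
      suc (length u′)            ≤⟨ from-last-β K (front slack N) (const N) B u⊆target ⟩
      B + N                      ≡⟨ cong (B +_) N≡ ⟩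
      B + (6 * κ * Z + Z * 2)    ≤⟨ last-β-loss κ Z (s≤s z≤n) ⟩
      κ + 10 * (κ * Z)           ≡⟨ L₀≡ ⟨
      L₀                         ∎
      where open ℕₚ.≤-Reasoning

  module _ (conf : Confusion {c = c} {t = t} A y enc pad Q?) where

    open Confusion conf

    private
      source : List (Sym κ)
      source = replicate c last-β ++ power t (block h)

      source-form : Vec.toList x₀ ≡ List.map ι source
      source-form = begin
        Vec.toList x₀                                                     ≡⟨ x₀-form ⟩
        Vec.toList pad ++ power t (word enc h)                            ≡⟨ cong₂ (λ l l′ → l ++ power t l′) (toList-replicate c (ι last-β)) (word≡ h) ⟩
        replicate c (ι last-β) ++ power t (List.map ι (block h))          ≡⟨ cong₂ _++_ (Listₚ.map-replicate ι c last-β) (map-power ι t (block h)) ⟨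
        List.map ι (replicate c last-β) ++ List.map ι (power t (block h)) ≡⟨ Listₚ.map-++ ι (replicate c last-β) _ ⟨
        List.map ι source                                                      ∎
        where open ≡-Reasoning

    upper : ∀ w → CommonSubseq w (Vec.toList x₀) (Vec.toList y) → length w ≤ L₀
    upper w (w⊆x , w⊆y) = preimage (⊆-map⁻ ι source (subst (w ⊆_) source-form w⊆x))
      where
      preimage : ∃[ u ] (w ≡ List.map ι u × u ⊆ source) → length w ≤ L₀
      preimage (u , w≡ , u⊆source) = subst (_≤ L₀) (trans (sym (Listₚ.length-map ι u)) (cong length (sym w≡)))
        (L₀-bound h (⊆-map-injective ι-injective (subst₂ _⊆_ w≡ (toList-vecOf ylist length-ylist) w⊆y))
                    (⊆-replicate-++⁻ c u⊆source))

    gains : ℕ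
    gains = ∑ (allFin κ) (λ a → 𝟙 (does (Q? h (v a) a)))

    private
      ridges : ∀ a → Ridge (Vec.lookup h a) (Vec.lookup (v a) a) (𝟙 (does (Q? h (v a) a)))
      ridges a = ridge (Vec.lookup h a) (Vec.lookup (v a) a) (Vec.lookup (v a) a ≟ᵥ Vec.lookup h a)

      left right : Fin κ → ℕ
      left a = Ridge.A (ridges a)
      right a = Ridge.C (ridges a)

      rest : ℕ
      rest = 6 * κ ∸ σ

      ridgeline : List (Sym κ)
      ridgeline = chunks (λ a → plateau (left a) B (right a))

      -- Blocks before the triples serve the first chunk and blocks after them the last one, with Z
      -- α's each; the triple of index `a` serves chunk `a`. The total meets `L₀` exactly, plus one
      -- for each deviation.
      common : List (Sym κ)
      common = replicate (σ * Z) (first false) ++ ridgeline ++ replicate (rest * Z) (fromℕ K , false)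

      gadget⊆word : ∀ h a → List.map (λ b → ι (a , b)) (gadget (Vec.lookup h a)) ⊆ word enc h
      gadget⊆word h a = subst₂ _⊆_ (sym (Listₚ.map-∘ (gadget (Vec.lookup h a)))) (sym (word≡ h)) (⊆ₚ.map⁺ ι (gadget⊆block h a))

      αs⊆word : ∀ a → replicate Z (ι (a , false)) ⊆ word enc h
      αs⊆word a = subst (_⊆ word enc h) (Listₚ.map-replicate (λ b → ι (a , b)) Z false)
        (⊆-trans (⊆ₚ.map⁺ (λ b → ι (a , b)) (falses⊆gadget (Vec.lookup h a))) (gadget⊆word h a))

      ridge⊆triple : ∀ a → List.map (λ b → ι (a , b)) (plateau (left a) B (right a)) ⊆ triple enc h (v a)
      ridge⊆triple a = ⊆-trans (⊆ₚ.map⁺ f (Ridge.⊆gadgets (ridges a)))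
        (subst (_⊆ triple enc h (v a)) (sym (trans (Listₚ.map-++ f g (g′ ++ g)) (cong (List.map f g ++_) (Listₚ.map-++ f g′ g))))
          (⊆ₚ.++⁺ (gadget⊆word h a) (⊆ₚ.++⁺ (gadget⊆word (v a) a) (gadget⊆word h a))))
        where
        f : Bool → Fin k
        f b = ι (a , b)
        g = gadget (Vec.lookup h a)
        g′ = gadget (Vec.lookup (v a) a)

      common⊆x : List.map ι common ⊆ Vec.toList x₁
      common⊆x = subst₂ _⊆_ (sym common-form) (sym x₁-form) (⊆ₚ.++⁺ˡ (Vec.toList pad)
        (⊆ₚ.++⁺ (replicate-⊆-power σ (αs⊆word zero))
          (⊆ₚ.++⁺ (chunks⊆concat ι (λ a → plateau (left a) B (right a)) (λ a → triple enc h (v a)) ridge⊆triple)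
            (replicate-⊆-power rest (αs⊆word (fromℕ K))))))
        where
        common-form : List.map ι common ≡ replicate (σ * Z) (ι (first false)) ++ List.map ι ridgeline ++
                                          replicate (rest * Z) (ι (fromℕ K , false))
        common-form = trans (Listₚ.map-++ ι (replicate (σ * Z) (first false)) _)
          (cong₂ _++_ (Listₚ.map-replicate ι (σ * Z) (first false))
            (trans (Listₚ.map-++ ι ridgeline _)
              (cong (List.map ι ridgeline ++_) (Listₚ.map-replicate ι (rest * Z) (fromℕ K , false)))))

      6κ : σ + rest ≡ 6 * κ
      6κ = ℕₚ.m+[n∸m]≡n σ≤6K

      common⊆y : List.map ι common ⊆ Vec.toList y
      common⊆y = subst (List.map ι common ⊆_) (sym (toList-vecOf ylist length-ylist)) (⊆ₚ.map⁺ ι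
        (chunks⊆target K {slack} {N} {B} {σ * Z} {rest * Z} {Z * 2} left right
          (Ridge.A≤2z ∘ ridges) (Ridge.C≤2z ∘ ridges)
          (ℕₚ.≤-trans (ℕₚ.≤-trans (ℕₚ.+-monoˡ-≤ (Z * 2) (ℕₚ.*-monoˡ-≤ Z σ≤6K)) (ℕₚ.≤-reflexive (sym N≡))) (ℕₚ.m≤n+m N slack))
          (ℕₚ.≤-trans (ℕₚ.≤-reflexive (ℕₚ.+-comm (Z * 2) (rest * Z)))
            (ℕₚ.≤-trans (ℕₚ.+-monoˡ-≤ (Z * 2) (ℕₚ.*-monoˡ-≤ Z (ℕₚ.m∸n≤m (6 * κ) σ))) (ℕₚ.≤-reflexive (sym N≡))))))

      length-ridgeline : length ridgeline ≡ κ * (Z * 4 + 1) + gains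
      length-ridgeline = begin
        length ridgeline                                          ≡⟨ length-chunks (λ a → plateau (left a) B (right a)) ⟩
        ∑ (allFin κ) (λ a → length (plateau (left a) B (right a))) ≡⟨ ∑-cong (allFin κ) length-ridge ⟩
        ∑ (allFin κ) (λ a → Z * 4 + 1 + 𝟙 (does (Q? h (v a) a)))  ≡⟨ ∑-+ (allFin κ) (const (Z * 4 + 1)) _ ⟩
        ∑ (allFin κ) (const (Z * 4 + 1)) + gains                  ≡⟨ cong (_+ gains) (trans (∑-const (allFin κ) (Z * 4 + 1))
                                                                       (cong (_* (Z * 4 + 1)) (Listₚ.length-tabulate {n = κ} Function.id))) ⟩
        κ * (Z * 4 + 1) + gains                                   ∎
        where
        open ≡-Reasoning
        length-ridge : ∀ a → length (plateau (left a) B (right a)) ≡ Z * 4 + 1 + 𝟙 (does (Q? h (v a) a))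
        length-ridge a = begin
          length (plateau (left a) B (right a))             ≡⟨ length-plateau (left a) B (right a) ⟩
          left a + (B + right a)                            ≡⟨ e₁ (left a) B (right a) ⟩
          B + (left a + right a)                            ≡⟨ cong (B +_) (Ridge.A+C (ridges a)) ⟩
          Z * 2 + 1 + (Z * 2 + 𝟙 (does (Q? h (v a) a)))     ≡⟨ e₂ Z _ ⟩
          Z * 4 + 1 + 𝟙 (does (Q? h (v a) a))               ∎
          where
          e₁ : ∀ a b c → a + (b + c) ≡ b + (a + c)
          e₁ = solve-∀
          e₂ : ∀ Z g → Z * 2 + 1 + (Z * 2 + g) ≡ Z * 4 + 1 + g
          e₂ = solve-∀

      length-common : length (List.map ι common) ≡ L₀ + gains
      length-common = begin
        length (List.map ι common)                                 ≡⟨ Listₚ.length-map ι common ⟩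
        length common                                              ≡⟨ trans (Listₚ.length-++ (replicate (σ * Z) (first {K} false)))
                                                                        (cong₂ _+_ (Listₚ.length-replicate (σ * Z))
                                                                          (trans (Listₚ.length-++ ridgeline)
                                                                            (cong₂ _+_ length-ridgeline (Listₚ.length-replicate (rest * Z))))) ⟩
        σ * Z + (κ * (Z * 4 + 1) + gains + rest * Z)               ≡⟨ e₁ σ Z κ gains rest ⟩
        (σ + rest) * Z + κ * (Z * 4 + 1) + gains                   ≡⟨ cong (λ e → e * Z + κ * (Z * 4 + 1) + gains) 6κ ⟩
        6 * κ * Z + κ * (Z * 4 + 1) + gains                        ≡⟨ cong (_+ gains) (e₂ κ Z) ⟩
        κ + 10 * (κ * Z) + gains                                   ≡⟨ cong (_+ gains) L₀≡ ⟨
        L₀ + gains                                                 ∎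
        where
        open ≡-Reasoning
        e₁ : ∀ σ Z κ g r → σ * Z + (κ * (Z * 4 + 1) + g + r * Z) ≡ (σ + r) * Z + κ * (Z * 4 + 1) + g
        e₁ = solve-∀
        e₂ : ∀ κ Z → 6 * κ * Z + κ * (Z * 4 + 1) ≡ κ + 10 * (κ * Z)
        e₂ = solve-∀

    -- At least 3κ/16 deviations stand against an allowance of ε L₀. Since L₀ ≤ 11κZ, the factor κ
    -- cancels, and 16 · 11 = 176.
    confused : 3 * suc d ≤ 176 * (p * Z)
    confused = ℕₚ.*-cancelˡ-≤ κ (begin
      κ * (3 * suc d)                    ≡⟨ e₁ κ (suc d) ⟩
      3 * κ * suc d                      ≤⟨ ℕₚ.*-monoˡ-≤ (suc d) many ⟩
      16 * gains * suc d                 ≡⟨ ℕₚ.*-assoc 16 gains (suc d) ⟩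
      16 * (gains * suc d)               ≤⟨ ℕₚ.*-monoʳ-≤ 16 gains-small ⟩
      16 * (p * L₀)                      ≤⟨ ℕₚ.*-monoʳ-≤ 16 (ℕₚ.*-monoʳ-≤ p (ℕₚ.≤-trans (ℕₚ.≤-reflexive L₀≡) (ℕₚ.+-monoˡ-≤ (10 * (κ * Z)) κ≤κZ))) ⟩
      16 * (p * (κ * Z + 10 * (κ * Z)))  ≡⟨ e₂ p κ Z ⟩
      κ * (176 * (p * Z))                ∎)
      where
      open ℕₚ.≤-Reasoning
      e₁ : ∀ κ q → κ * (3 * q) ≡ 3 * κ * q
      e₁ = solve-∀
      e₂ : ∀ p κ Z → 16 * (p * (κ * Z + 10 * (κ * Z))) ≡ κ * (176 * (p * Z))
      e₂ = solve-∀
      e₃ : ∀ q p L → (q + p) * L ≡ L * q + p * L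
      e₃ = solve-∀
      ratio : (L₀ + gains) * suc d ≤ (suc d + p) * L₀
      ratio = same-output⇒ratio ε p d ε≡p/d A approx x₀ x₁ y same-output L₀ (L₀ + gains) upper
        (List.map ι common , (common⊆x , common⊆y) , ℕₚ.≤-reflexive (sym length-common))
      gains-small : gains * suc d ≤ p * L₀
      gains-small = ℕₚ.+-cancelˡ-≤ (L₀ * suc d) _ _ (begin
        L₀ * suc d + gains * suc d       ≡⟨ ℕₚ.*-distribʳ-+ (suc d) L₀ gains ⟨
        (L₀ + gains) * suc d             ≤⟨ ratio ⟩
        (suc d + p) * L₀                 ≡⟨ e₃ (suc d) p L₀ ⟩
        L₀ * suc d + p * L₀              ∎)

  regime-II : 3 * suc d ≤ 176 * (p * Z)
  regime-II = confused (confusion {c = c} {t = t} t≡9κ A y enc pad hs (choices-unique (λ _ → bits-unique Z)) hs≢[]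
    (s≤s z≤n) Q? (2 ^ (Z * (κ / 2))) sparse⇒small few)

-- Choice of the parameters

-- Without memory, 0ⁿ and 1ⁿ look the same against y = 0ⁿ.
module _ {k n R : ℕ} (ε : ℚ) (p d : ℕ) (ε≡p/d : toℚᵘ ε ≡ mkℚᵘ (ℤ.+ p) d) where

  needs-memory : (A : Alg (2 + k) (suc n) R 0) → ¬ Approximates A ε
  needs-memory A approx = ℕₚ.<-irrefl refl (ℕₚ.<-≤-trans (s≤s z≤n)
    (subst (1 * suc d ≤_) (ℕₚ.*-zeroʳ (suc d + p))
      (same-output⇒ratio ε p d ε≡p/d A approx (word₁ (suc zero)) y y same 0 1 upper
        (Vec.toList y , (⊆-refl , ⊆-refl) , s≤s z≤n))))
    where
    word₁ : Fin (2 + k) → Vec (Fin (2 + k)) (suc n)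
    word₁ = Vec.replicate (suc n)
    y = word₁ zero
    Fin1 : (i j : Fin 1) → i ≡ j
    Fin1 zero zero = refl
    same : output A y y ≡ output A y (word₁ (suc zero))
    same = cong (Alg.out A y) (Fin1 _ _)
    only : ∀ {u} x → u ∈ Vec.toList (word₁ x) → u ≡ x
    only {u} x u∈ = ∈-replicate⁻ (suc n) (subst (u ∈_) (toList-replicate (suc n) x) u∈)
    upper : ∀ z → CommonSubseq z (Vec.toList (word₁ (suc zero))) (Vec.toList y) → length z ≤ 0
    upper [] _ = z≤n
    upper (u ∷ z) (z⊆x , z⊆y) with trans (sym (only (suc zero) (⊆.lookup z⊆x (here refl)))) (only zero (⊆.lookup z⊆y (here refl)))
    ... | ()

bit : Bool → Fin 2
bit true = suc zero
bit false = zero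

bit-injective : ∀ {b b′} → bit b ≡ bit b′ → b ≡ b′
bit-injective {true} {true} _ = refl
bit-injective {false} {false} _ = refl

embed : ∀ κ {k} → κ * 2 ≤ k → Sym κ → Fin k
embed κ 2κ≤k (a , b) = Fin.inject≤ (Fin.combine a (bit b)) 2κ≤k

embed-injective : ∀ κ {k} (2κ≤k : κ * 2 ≤ k) {a b} → embed κ 2κ≤k a ≡ embed κ 2κ≤k b → a ≡ b
embed-injective κ 2κ≤k {a , b} {a′ , b′} eq
  with Finₚ.combine-injective a (bit b) a′ (bit b′) (Finₚ.inject≤-injective 2κ≤k 2κ≤k _ _ eq)
... | refl , eq′ = cong (a ,_) (bit-injective eq′)

module _ (ε : ℚ) (p d : ℕ) (ε≡p/d : toℚᵘ ε ≡ mkℚᵘ (ℤ.+ p) d) where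

  private q = suc d

  regime-I : ∀ {K w n R s} → 1 ≤ K → K ≤ n → 9 * K * w ≤ n → (A : Alg (suc K) n R s) → Approximates A ε →
             2 + (s + s) * R ≤ w → 3 * K * q ≤ 16 * ((q + p) * suc w)
  regime-I {K} {w} {n} {R} {s} 1≤K K≤n fits A approx =
    go (n ∸ 9 * K * w) (9 * K) refl n (sym (ℕₚ.m∸n+n≡m fits)) K≤n A approx
    where
    -- The value meant for `c` contains `n`, so `n ≡ c + t * w` can be matched with `refl` only
    -- after `c` has been made a variable.
    go : ∀ c t → t ≡ 9 * K → ∀ n → n ≡ c + t * w → K ≤ n → (A : Alg (suc K) n R s) → Approximates A ε →
         2 + (s + s) * R ≤ w → 3 * K * q ≤ 16 * ((q + p) * suc w)
    go c t t≡9K _ refl K≤n A approx low = RegimeI.regime-I {c = c} {t = t} t≡9K K≤n (Fin.fromℕ< 1≤K) ε p d ε≡p/d A approx low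

  regime-II : ∀ {k K z n R s} (let κ = suc K) (let Z = suc z) → κ * 2 ≤ k → 27 * (κ * κ * Z) ≤ n →
              (A : Alg k n R s) → Approximates A ε → 4 + 2 * ((s + s) * R) ≤ Z * κ → 3 * q ≤ 176 * (p * Z)
  regime-II {k} {K} {z} {n} {R} {s} 2κ≤k fits A approx =
    go (n ∸ 9 * κ * (κ * (Z * 3))) (9 * κ) (κ * (Z * 3)) (6 * κ * Z + Z * 2) refl refl refl
      n (sym (ℕₚ.m∸n+n≡m fits-x)) fits-y A approx
    where
    κ = suc K
    Z = suc z
    go : ∀ c t ℓ N → t ≡ 9 * κ → ℓ ≡ κ * (Z * 3) → N ≡ 6 * κ * Z + Z * 2 → ∀ n → n ≡ c + t * ℓ →
         κ * (N + ((Z * 2 + 1) + N)) ≤ n → (A : Alg k n R s) → Approximates A ε →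
         4 + 2 * ((s + s) * R) ≤ Z * κ → 3 * q ≤ 176 * (p * Z)
    go c t ℓ N t≡ ℓ≡ N≡ _ refl fits A approx low =
      RegimeII.regime-II {c = c} {t = t} {ℓ = ℓ} {N = N} t≡ ℓ≡ N≡ (embed κ 2κ≤k) (embed-injective κ 2κ≤k) fits ε p d ε≡p/d A approx low
    -- `x` has 9κ blocks of length 3κZ, hence the factor 27; for `y` a factor 19 is enough.
    fits-x : 9 * κ * (κ * (Z * 3)) ≤ n
    fits-x = subst (_≤ n) (e κ Z) fits
      where e : ∀ κ Z → 27 * (κ * κ * Z) ≡ 9 * κ * (κ * (Z * 3))
            e = solve-∀
    fits-y : κ * ((6 * κ * Z + Z * 2) + ((Z * 2 + 1) + (6 * κ * Z + Z * 2))) ≤ n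
    fits-y = begin
      κ * ((6 * κ * Z + Z * 2) + ((Z * 2 + 1) + (6 * κ * Z + Z * 2)))  ≡⟨ e κ Z ⟩
      12 * (κ * κ * Z) + (6 * (κ * Z) + κ)                             ≤⟨ ℕₚ.+-monoʳ-≤ (12 * (κ * κ * Z))
                                                                            (ℕₚ.+-mono-≤ (ℕₚ.*-monoʳ-≤ 6 κZ≤κκZ) (ℕₚ.≤-trans (ℕₚ.m≤m*n κ Z) κZ≤κκZ)) ⟩
      12 * (κ * κ * Z) + (6 * (κ * κ * Z) + κ * κ * Z)                 ≡⟨ e′ (κ * κ * Z) ⟩
      19 * (κ * κ * Z)                                                 ≤⟨ ℕₚ.*-monoˡ-≤ (κ * κ * Z) (ℕₚ.≤ᵇ⇒≤ 19 27 tt) ⟩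
      27 * (κ * κ * Z)                                                 ≤⟨ fits ⟩
      n                                                                ∎
      where
      open ℕₚ.≤-Reasoning
      e : ∀ κ Z → κ * ((6 * κ * Z + Z * 2) + ((Z * 2 + 1) + (6 * κ * Z + Z * 2))) ≡ 12 * (κ * κ * Z) + (6 * (κ * Z) + κ)
      e = solve-∀
      e′ : ∀ m → 12 * m + (6 * m + m) ≡ 19 * m
      e′ = solve-∀
      κZ≤κκZ : κ * Z ≤ κ * κ * Z
      κZ≤κκZ = ℕₚ.*-monoˡ-≤ Z (ℕₚ.m≤m*n κ κ)

  -- With ε = p/q, the word parameters are z ~ 1/(64 C ε) in the second regime and
  -- w ~ k/(2048 C ε) in the first; P stands for C p and S for s R.
  private
    memory-II : ∀ D {k κ Z P S} → k ≤ 3 * κ → q ≤ 2 * Z * (D * P) → Z * κ ≤ 7 * S → k * q ≤ 42 * D * (P * S)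
    memory-II D {k} {κ} {Z} {P} {S} k≤3κ q≤ Zκ≤7S = begin
      k * q                            ≤⟨ ℕₚ.*-mono-≤ k≤3κ q≤ ⟩
      3 * κ * (2 * Z * (D * P))        ≡⟨ e₁ κ Z D P ⟩
      6 * D * P * (Z * κ)              ≤⟨ ℕₚ.*-monoʳ-≤ (6 * D * P) Zκ≤7S ⟩
      6 * D * P * (7 * S)              ≡⟨ e₂ D P S ⟩
      42 * D * (P * S)                 ∎
      where
      open ℕₚ.≤-Reasoning
      e₁ : ∀ κ Z D P → 3 * κ * (2 * Z * (D * P)) ≡ 6 * D * P * (Z * κ)
      e₁ = solve-∀
      e₂ : ∀ D P S → 6 * D * P * (7 * S) ≡ 42 * D * (P * S)
      e₂ = solve-∀

    memory-I : ∀ D {k w P S} → k * q ≤ 2 * w * (D * P) → w ≤ 3 * S → k * q ≤ 6 * D * (P * S)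
    memory-I D {k} {w} {P} {S} kq≤ w≤3S = begin
      k * q                            ≤⟨ kq≤ ⟩
      2 * w * (D * P)                  ≤⟨ ℕₚ.*-monoˡ-≤ (D * P) (ℕₚ.*-monoʳ-≤ 2 w≤3S) ⟩
      2 * (3 * S) * (D * P)            ≡⟨ e D P S ⟩
      6 * D * (P * S)                  ∎
      where
      open ℕₚ.≤-Reasoning
      e : ∀ D P S → 2 * (3 * S) * (D * P) ≡ 6 * D * (P * S)
      e = solve-∀

    -- Here |Σ|²/ε = O(n) is used: it leaves room for strings of length of order κ²Z.
    size-II : ∀ D {C k κ Z n} → 1 ≤ C * p → 2 * κ ≤ k → Z * (D * (C * p)) ≤ q → k * k * q ≤ C * n * p →
              4 * D * (κ * κ * Z) ≤ n
    size-II D {C} {k} {κ} {Z} {n} 1≤Cp 2κ≤k ZD≤q k²q≤ = ℕₚ.*-cancelʳ-≤ _ _ (C * p) {{ℕ.>-nonZero 1≤Cp}} (begin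
      4 * D * (κ * κ * Z) * (C * p)             ≡⟨ e D κ Z (C * p) ⟩
      2 * κ * (2 * κ) * (Z * (D * (C * p)))     ≤⟨ ℕₚ.*-mono-≤ (ℕₚ.*-mono-≤ 2κ≤k 2κ≤k) ZD≤q ⟩
      k * k * q                                 ≤⟨ k²q≤ ⟩
      C * n * p                                 ≡⟨ e′ C n p ⟩
      n * (C * p)                               ∎)
      where
      open ℕₚ.≤-Reasoning
      e : ∀ D κ Z P → 4 * D * (κ * κ * Z) * P ≡ 2 * κ * (2 * κ) * (Z * (D * P))
      e = solve-∀
      e′ : ∀ C n p → C * n * p ≡ n * (C * p)
      e′ = solve-∀

    size-I : ∀ D {C k w n} → 1 ≤ C * p → w * (D * (C * p)) ≤ k * q → k * k * q ≤ C * n * p → D * (k * w) ≤ n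
    size-I D {C} {k} {w} {n} 1≤Cp wD≤kq k²q≤ = ℕₚ.*-cancelʳ-≤ _ _ (C * p) {{ℕ.>-nonZero 1≤Cp}} (begin
      D * (k * w) * (C * p)         ≡⟨ e D k w (C * p) ⟩
      k * (w * (D * (C * p)))       ≤⟨ ℕₚ.*-monoʳ-≤ k wD≤kq ⟩
      k * (k * q)                   ≡⟨ ℕₚ.*-assoc k k q ⟨
      k * k * q                     ≤⟨ k²q≤ ⟩
      C * n * p                     ≡⟨ e′ C n p ⟩
      n * (C * p)                   ∎)
      where
      open ℕₚ.≤-Reasoning
      e : ∀ D k w P → D * (k * w) * P ≡ k * (w * (D * P))
      e = solve-∀
      e′ : ∀ C n p → C * n * p ≡ n * (C * p)
      e′ = solve-∀

    -- The divisor 64 is large enough because 3 · 64 = 192 exceeds 176.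
    impossible-II : ∀ {P Z} → 1 ≤ p → 1 ≤ Z → p ≤ P → Z * (64 * P) ≤ q → ¬ 3 * q ≤ 176 * (p * Z)
    impossible-II {P} {Z} 1≤p 1≤Z p≤P ZD≤q 3q≤ = ℕₚ.<-irrefl refl (begin-strict
      176 * (p * Z)          <⟨ ℕₚ.*-monoˡ-< (p * Z) {{ℕ.>-nonZero (ℕₚ.*-mono-≤ 1≤p 1≤Z)}} (ℕₚ.≤ᵇ⇒≤ 177 192 tt) ⟩
      192 * (p * Z)          ≡⟨ e 64 p Z ⟩
      3 * (Z * (64 * p))     ≤⟨ ℕₚ.*-monoʳ-≤ 3 (ℕₚ.*-monoʳ-≤ Z (ℕₚ.*-monoʳ-≤ 64 p≤P)) ⟩
      3 * (Z * (64 * P))     ≤⟨ ℕₚ.*-monoʳ-≤ 3 ZD≤q ⟩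
      3 * q                  ≤⟨ 3q≤ ⟩
      176 * (p * Z)          ∎)
      where
      open ℕₚ.≤-Reasoning
      e : ∀ D p Z → 3 * D * (p * Z) ≡ 3 * (Z * (D * p))
      e = solve-∀

    -- Rounding costs a factor 2 in `suc w ≤ 2 * w` and another in `k ≤ 2 * K`, and q + p is at most
    -- 65P. The divisor 2048 works because 16 · 65 · 2 · 2 = 4160 is below 3 · 2048 = 6144.
    impossible-I : ∀ {P K k w} → 1 ≤ K → 1 ≤ w → p ≤ P → k ≤ 2 * K → q ≤ 64 * P → w * (2048 * P) ≤ k * q →
                   ¬ 3 * K * q ≤ 16 * ((q + p) * suc w)
    impossible-I {P} {K} {k} {w} 1≤K 1≤w p≤P k≤2K q≤ wD≤kq 3Kq≤ = ℕₚ.<-irrefl refl (begin-strict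
      2048 * (3 * K * q)                 ≤⟨ ℕₚ.*-monoʳ-≤ 2048 (ℕₚ.≤-trans 3Kq≤ (ℕₚ.*-monoʳ-≤ 16 (ℕₚ.*-mono-≤ q+p≤ 1+w≤))) ⟩
      2048 * (16 * (65 * P * (2 * w)))   ≡⟨ e₁ 2048 16 65 P w ⟩
      32 * 65 * (w * (2048 * P))         ≤⟨ ℕₚ.*-monoʳ-≤ (32 * 65) (ℕₚ.≤-trans wD≤kq (ℕₚ.*-monoˡ-≤ q k≤2K)) ⟩
      32 * 65 * (2 * K * q)              ≡⟨ e₂ (32 * 65) K q ⟩
      4160 * (K * q)                     <⟨ ℕₚ.*-monoˡ-< (K * q) {{ℕ.>-nonZero (ℕₚ.*-mono-≤ 1≤K (s≤s z≤n))}} (ℕₚ.≤ᵇ⇒≤ 4161 6144 tt) ⟩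
      6144 * (K * q)                     ≡⟨ e₃ 2048 K q ⟨
      2048 * (3 * K * q)                 ∎)
      where
      open ℕₚ.≤-Reasoning
      q+p≤ : q + p ≤ 65 * P
      q+p≤ = ℕₚ.≤-trans (ℕₚ.+-mono-≤ q≤ p≤P) (ℕₚ.≤-reflexive (ℕₚ.+-comm (64 * P) P))
      1+w≤ : suc w ≤ 2 * w
      1+w≤ = ℕₚ.≤-trans (ℕₚ.+-monoˡ-≤ w 1≤w) (ℕₚ.≤-reflexive (cong (w +_) (sym (ℕₚ.+-identityʳ w))))
      e₁ : ∀ D a b P w → D * (a * (b * P * (2 * w))) ≡ a * 2 * b * (w * (D * P))
      e₁ = solve-∀
      e₂ : ∀ a K q → a * (2 * K * q) ≡ a * 2 * (K * q)
      e₂ = solve-∀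
      e₃ : ∀ D K q → D * (3 * K * q) ≡ D * 3 * (K * q)
      e₃ = solve-∀

  private
    double : ∀ {m} → 1 ≤ m → suc m ≤ 2 * m
    double {m} 1≤m = ℕₚ.≤-trans (ℕₚ.+-monoˡ-≤ m 1≤m) (ℕₚ.≤-reflexive (cong (m +_) (sym (ℕₚ.+-identityʳ m))))

    large-ε : ∀ {C k n R s} w → 1 ≤ p → 1 ≤ C → 2 ≤ k → 1 ≤ s * R → k * k * q ≤ C * n * p →
              (A : Alg k n R s) → Approximates A ε → q ≤ 64 * (C * p) →
              w * (2048 * (C * p)) ≤ k * q → k * q < suc w * (2048 * (C * p)) →
              k * q ≤ 6 * 2048 * (C * p * (s * R))
    -- For `w = 0` the hidden words are empty, but then kq is below 2048P, and `1 ≤ s * R` gives the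
    -- bound directly.
    large-ε {C} {k} {R = R} {s} zero 1≤p 1≤C 2≤k 1≤S k²q≤ A approx q≤ wD≤ kq< = begin
      k * q                          ≤⟨ ℕₚ.<⇒≤ kq< ⟩
      2048 * P + 0                   ≡⟨ ℕₚ.+-identityʳ (2048 * P) ⟩
      2048 * P                       ≤⟨ ℕₚ.*-monoˡ-≤ P (ℕₚ.≤ᵇ⇒≤ 2048 (6 * 2048) tt) ⟩
      6 * 2048 * P                   ≤⟨ ℕₚ.*-monoʳ-≤ (6 * 2048) (ℕₚ.m≤m*n P (s * R) {{ℕ.>-nonZero 1≤S}}) ⟩
      6 * 2048 * (P * (s * R))       ∎
      where
      open ℕₚ.≤-Reasoning
      P = C * p
    large-ε {C} {suc K} {n} {R} {s} w@(suc _) 1≤p 1≤C (s≤s 1≤K) 1≤S k²q≤ A approx q≤ wD≤ kq<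
      = decide (2 + (s + s) * R ≤? w)
      where
      open ℕₚ.≤-Reasoning
      k = suc K
      k≤2K : k ≤ 2 * K
      k≤2K = double 1≤K
      big : 2048 * (k * w) ≤ n
      big = size-I 2048 {C} {k} {w} {n} (ℕₚ.*-mono-≤ 1≤C 1≤p) wD≤ k²q≤
      K≤n : K ≤ n
      K≤n = ℕₚ.≤-trans (ℕₚ.n≤1+n K) (ℕₚ.≤-trans (ℕₚ.m≤m*n k w) (ℕₚ.≤-trans (ℕₚ.m≤n*m (k * w) 2048) big))
      9Kw≤n : 9 * K * w ≤ n
      9Kw≤n = begin
        9 * K * w          ≡⟨ ℕₚ.*-assoc 9 K w ⟩
        9 * (K * w)        ≤⟨ ℕₚ.*-mono-≤ (ℕₚ.≤ᵇ⇒≤ 9 2048 tt) (ℕₚ.*-monoˡ-≤ w (ℕₚ.n≤1+n K)) ⟩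
        2048 * (k * w)     ≤⟨ big ⟩
        n                  ∎
      e : ∀ s R → s * R + (s + s) * R ≡ 3 * (s * R)
      e = solve-∀
      decide : Dec (2 + (s + s) * R ≤ w) → k * q ≤ 6 * 2048 * (C * p * (s * R))
      decide (yes low) = contradiction
        (regime-I {K} {w} {n} {R} {s} 1≤K K≤n 9Kw≤n A approx low)
        (impossible-I {C * p} {K} {k} {w} 1≤K (s≤s z≤n) (ℕₚ.m≤n*m p C {{ℕ.>-nonZero 1≤C}}) k≤2K q≤ wD≤)
      decide (no ¬low) = memory-I 2048 {k} {w} {C * p} {s * R}
        (ℕₚ.≤-trans (ℕₚ.<⇒≤ kq<) (ℕₚ.*-monoˡ-≤ (2048 * (C * p)) (double {w} (s≤s z≤n)))) (begin
        w                          ≤⟨ ℕₚ.≤-pred (ℕₚ.≰⇒> ¬low) ⟩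
        1 + (s + s) * R            ≤⟨ ℕₚ.+-monoˡ-≤ ((s + s) * R) 1≤S ⟩
        s * R + (s + s) * R        ≡⟨ e s R ⟩
        3 * (s * R)                ∎)

  module _ {C k n R s : ℕ} (1≤p : 1 ≤ p) (1≤C : 1 ≤ C) (2≤k : 2 ≤ k) (1≤R : 1 ≤ R) (1≤s : 1 ≤ s)
           (k²q≤Cnp : k * k * q ≤ C * n * p) (A : Alg k n R s) (approx : Approximates A ε) where

    private
      P S : ℕ
      P = C * p
      S = s * R

      1≤P : 1 ≤ P
      1≤P = ℕₚ.*-mono-≤ 1≤C 1≤p

      1≤S : 1 ≤ S
      1≤S = ℕₚ.*-mono-≤ 1≤s 1≤R

      p≤P : p ≤ P
      p≤P = ℕₚ.m≤n*m p C {{ℕ.>-nonZero 1≤C}}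

      Goal : Set
      Goal = k * q ≤ 16384 * (P * S)

      enlarge : ∀ M → M ≤ 16384 → k * q ≤ M * (P * S) → Goal
      enlarge M M≤ le = ℕₚ.≤-trans le (ℕₚ.*-monoˡ-≤ (P * S) M≤)

      small-ε : ∀ κ z → 1 ≤ κ → 2 * κ ≤ k → k < suc κ * 2 → 1 ≤ z →
                z * (64 * P) ≤ q → q < suc z * (64 * P) → Goal
      small-ε κ@(suc K) Z@(suc z) 1≤κ 2κ≤k k< 1≤Z ZD≤q q< = decide (4 + 2 * ((s + s) * R) ≤? Z * κ)
        where
        open ℕₚ.≤-Reasoning
        k≤3κ : k ≤ 3 * κ
        k≤3κ = begin
          k                  ≤⟨ ℕₚ.≤-pred k< ⟩
          suc (κ * 2)        ≤⟨ ℕₚ.+-monoˡ-≤ (κ * 2) 1≤κ ⟩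
          κ + κ * 2          ≡⟨ cong (κ +_) (ℕₚ.*-comm κ 2) ⟩
          3 * κ              ∎
        Zκ≤7S : ¬ 4 + 2 * ((s + s) * R) ≤ Z * κ → Z * κ ≤ 7 * S
        Zκ≤7S ¬low = begin
          Z * κ                        ≤⟨ ℕₚ.≤-pred (ℕₚ.≰⇒> ¬low) ⟩
          3 + 2 * ((s + s) * R)        ≡⟨ e s R ⟩
          3 + 4 * S                    ≤⟨ ℕₚ.+-monoˡ-≤ (4 * S) (ℕₚ.*-monoʳ-≤ 3 1≤S) ⟩
          3 * S + 4 * S                ≡⟨ ℕₚ.*-distribʳ-+ S 3 4 ⟨
          7 * S                        ∎
          where e : ∀ s R → 3 + 2 * ((s + s) * R) ≡ 3 + 4 * (s * R)
                e = solve-∀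
        decide : Dec (4 + 2 * ((s + s) * R) ≤ Z * κ) → Goal
        decide (yes low) = contradiction
          (regime-II {k} {K} {z} {n} {R} {s} (subst (_≤ k) (ℕₚ.*-comm 2 κ) 2κ≤k)
                     (ℕₚ.≤-trans (ℕₚ.*-monoˡ-≤ (κ * κ * Z) (ℕₚ.≤ᵇ⇒≤ 27 256 tt)) (size-II 64 {C} {k} {κ} {Z} {n} 1≤P 2κ≤k ZD≤q k²q≤Cnp)) A approx low)
          (impossible-II {P} {Z} 1≤p 1≤Z p≤P ZD≤q)
        decide (no ¬low) = enlarge (42 * 64) (ℕₚ.≤ᵇ⇒≤ (42 * 64) 16384 tt)
          (memory-II 64 {k} {κ} {Z} {P} {S} k≤3κ (ℕₚ.≤-trans (ℕₚ.<⇒≤ q<) (ℕₚ.*-monoˡ-≤ (64 * P) (double {Z} 1≤Z))) (Zκ≤7S ¬low))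

    memory-bound : Goal
    memory-bound = cases (q / (64 * P)) (div-lower q (64 * P)) (div-upper q (64 * P))
      where
      instance
        P≢0 : ℕ.NonZero P
        P≢0 = ℕ.>-nonZero 1≤P
        64P≢0 : ℕ.NonZero (64 * P)
        64P≢0 = ℕₚ.m*n≢0 64 P
        2048P≢0 : ℕ.NonZero (2048 * P)
        2048P≢0 = ℕₚ.m*n≢0 2048 P
      div-lower : ∀ m n .{{_ : ℕ.NonZero n}} → m / n * n ≤ m
      div-lower = DivMod.m/n*n≤m
      div-upper : ∀ m n .{{_ : ℕ.NonZero n}} → m < suc (m / n) * n
      div-upper m n = subst (_< suc (m / n) * n) (sym (DivMod.m≡m%n+[m/n]*n m n)) (ℕₚ.+-monoˡ-< (m / n * n) (DivMod.m%n<n m n))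
      cases : ∀ z → z * (64 * P) ≤ q → q < suc z * (64 * P) → Goal
      -- Quotient zero means ε > 1/(64C), the range of the increasing sequences.
      cases zero _ q< = enlarge (6 * 2048) (ℕₚ.≤ᵇ⇒≤ (6 * 2048) 16384 tt)
        (large-ε {C} {k} {n} {R} {s} (k * q / (2048 * P)) 1≤p 1≤C 2≤k 1≤S k²q≤Cnp A approx
          (ℕₚ.≤-trans (ℕₚ.<⇒≤ q<) (ℕₚ.≤-reflexive (ℕₚ.+-identityʳ (64 * P))))
          (div-lower (k * q) (2048 * P)) (div-upper (k * q) (2048 * P)))
      cases z@(suc _) = small-ε (k / 2) z (DivMod.m≥n⇒m/n>0 2≤k) (2*[n/2]≤n k) (div-upper k 2) (s≤s z≤n)

-- The additive constants in the low-memory conditions are absorbed into multiples of sR, which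
-- therefore has to be at least 1.
has-memory : ∀ {k n R s} (ε : ℚ) (p d : ℕ) → toℚᵘ ε ≡ mkℚᵘ (ℤ.+ p) d → 2 ≤ k → 1 ≤ n →
             (A : Alg k n R s) → Approximates A ε → 1 ≤ s
has-memory {s = suc s} ε p d ε≡p/d _ _ A approx = s≤s z≤n
has-memory {s = zero} ε p d ε≡p/d (s≤s (s≤s z≤n)) (s≤s z≤n) A approx = contradiction approx (needs-memory ε p d ε≡p/d A)

regroup : ∀ M C p s R m → m ≤ suc M * (suc C * p * (s * R)) → m ≤ suc (C + M * suc C) * (s * R * p)
regroup M C p s R m = subst (m ≤_) (e (suc M) (suc C) p s R)
  where e : ∀ M C p s R → M * (C * p * (s * R)) ≡ M * C * (s * R * p)
        e = solve-∀

theorem1p5 : (C : ℕ) → ∃[ c ] ((0ℚ ℚ.< c) ×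
    (∀ (k n R s : ℕ) (ε : ℚ) → 0ℚ ℚ.< ε → 2 ≤ k → 1 ≤ R →
    ⟦ k ℕ.* k ⟧ ℚ.≤ ⟦ C ℕ.* n ⟧ ℚ.* ε →
    (A : Alg k n R s) → Approximates A ε →
    c ℚ.* ⟦ k ⟧ ℚ.≤ ⟦ s ⟧ ℚ.* ⟦ R ⟧ ℚ.* ε))
theorem1p5 C = c , ℚₚ.positive⁻¹ c {{ℚₚ.normalize-pos 1 (suc D)}} , bound
  where
  -- `suc D` equals 16384 · (C + 1): 16384 is a common bound for 6 · 2048 and 42 · 64, and C + 1
  -- takes the place of C to be positive even for C = 0.
  D = C + 16383 * suc C
  c = ℤ.+ 1 ℚ./ suc D
  bound : ∀ (k n R s : ℕ) (ε : ℚ) → 0ℚ ℚ.< ε → 2 ≤ k → 1 ≤ R →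
          ⟦ k ℕ.* k ⟧ ℚ.≤ ⟦ C ℕ.* n ⟧ ℚ.* ε →
          (A : Alg k n R s) → Approximates A ε → c ℚ.* ⟦ k ⟧ ℚ.≤ ⟦ s ⟧ ℚ.* ⟦ R ⟧ ℚ.* ε
  bound k n R s (mkℚ (ℤ.-[1+ _ ]) _ _) (ℚ.*<* ())
  bound k n R s (mkℚ (ℤ.+ 0) _ _) (ℚ.*<* (ℤ.+<+ ()))
  bound k n R s ε@(mkℚ (ℤ.+ p@(suc _)) d _) 0<ε 2≤k 1≤R hyp A approx = ≤⇒≤-*ε ε p d refl k s R D (regroup 16383 C p s R (k * q)
    (memory-bound ε p d refl {C = suc C} (s≤s z≤n) (s≤s z≤n) 2≤k 1≤R
      (has-memory ε p d refl 2≤k (1≤n n k²q≤) A approx) k²q≤ A approx))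
    where
    q = suc d
    k²q≤ : k * k * q ≤ suc C * n * p
    k²q≤ = ℕₚ.≤-trans (≤-*ε⇒ ε p d refl (k * k) (C * n) hyp) (ℕₚ.*-monoˡ-≤ p (ℕₚ.*-monoˡ-≤ n (ℕₚ.n≤1+n C)))
    1≤n : ∀ n → k * k * q ≤ suc C * n * p → 1 ≤ n
    1≤n (suc n) _ = s≤s z≤n
    1≤n zero le = contradiction
      (ℕₚ.≤-trans (ℕₚ.*-mono-≤ (ℕₚ.*-mono-≤ 1≤k 1≤k) (s≤s {n = d} z≤n)) (subst (λ m → k * k * q ≤ m * p) (ℕₚ.*-zeroʳ C) le)) λ ()
      where 1≤k = ℕₚ.<⇒≤ 2≤k
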